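{- Let $n\ge 2$. If $S_1\in\{\{b,g\},\{b,s\},\{y,o\},\{g,s\}\}$ and $S_2\in\{\{r,y\},\{r,g\},\{y,g\},\{b,o\}\}$ then \[|J(T_n(S_1))|=|J(T_n(S_2))|=\prod_{j=1}^n C_j=\prod_{j=1}^n\frac{1}{j+1}\binom{2j}{j}=\prod_{1\le i\le j\le k\le n-1}\frac{i+j+2}{i+j},\] and \[F(J(T_n(S_1)),q)=F(J(T_n^*(S_2)),q)=\prod_{j=1}^n C_j(q).\]
   Context: Let $T_n$ be the set of triples $(c_1,c_2,c_3)$ of nonnegative integers with $c_1+c_2+c_3\le n-2$. To the colors $r,g,y,b,o,s$ associate $v_r=(1,0,0)$, $v_g=(0,1,0)$, $v_y=(0,0,1)$, $v_b=(-1,1,0)$, $v_o=(-1,0,1)$, $v_s=(0,1,-1)$. For a set $S$ of colors, $T_n(S)$ is the poset on $T_n$ whose order is the reflexive–transitive closure of $p<p+v_x$ for $x\in S$ and $p,p+v_x\in T_n$; $T_n^*(S)$ is its dual poset. $J(P)$ is the set of order ideals (down-closed subsets, including $\emptyset$) of $P$, and $F(J(P),q)=\sum_{I\in J(P)}q^{|I|}$. $C_j$ is the $j$th Catalan number, and $C_j(q)$ is the Carlitz–Riordan $q$-Catalan number defined by $C_0(q)=C_1(q)=1$ and $C_j(q)=\sum_{k=1}^j q^{k-1}C_{k-1}(q)C_{j-k}(q)$. -}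

module Defs where

open import Data.Nat as ℕ using (ℕ; zero; suc; _+_; _*_; _∸_; _≤?_)
open import Data.Nat.Combinatorics using (_C_)
open import Data.Integer as ℤ using (ℤ; +_; -[1+_])
open import Data.Rational as ℚ using (ℚ; 0ℚ; 1ℚ)
open import Data.Product using (Σ; _×_; _,_; ∃)
open import Data.List using (List; []; _∷_; map; foldr; upTo; filter; length; concatMap; zipWith; reverse; _++_; replicate; lookup)
open import Data.List.Membership.Propositional as LM using ()
open import Data.List.Relation.Unary.Unique.Propositional using (Unique)
open import Data.Fin using (Fin)
open import Data.Fin.Subset as Sub using (Subset)
open import Relation.Binary.PropositionalEquality using (_≡_)
open import Relation.Binary.Construct.Closure.ReflexiveTransitive using (Star)
open import Function using (flip)

data Color : Set where
  r g y b o s : Color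

ℤ³ : Set
ℤ³ = ℤ × ℤ × ℤ

vec : Color → ℤ³
vec r = (+ 1 , + 0 , + 0)
vec g = (+ 0 , + 1 , + 0)
vec y = (+ 0 , + 0 , + 1)
vec b = (-[1+ 0 ] , + 1 , + 0)
vec o = (-[1+ 0 ] , + 0 , + 1)
vec s = (+ 0 , + 1 , -[1+ 0 ])

_+³_ : ℤ³ → ℤ³ → ℤ³
(a₁ , a₂ , a₃) +³ (b₁ , b₂ , b₃) = (a₁ ℤ.+ b₁ , a₂ ℤ.+ b₂ , a₃ ℤ.+ b₃)

ℕ³ : Set
ℕ³ = ℕ × ℕ × ℕ

toℤ³ : ℕ³ → ℤ³
toℤ³ (c₁ , c₂ , c₃) = (+ c₁ , + c₂ , + c₃)

Tlist : ℕ → List ℕ³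
Tlist n =
  filter (λ { (c₁ , c₂ , c₃) → (c₁ + c₂ + c₃) ≤? (n ∸ 2) })
    (concatMap (λ c₁ → concatMap (λ c₂ → map (λ c₃ → (c₁ , c₂ , c₃))
       (upTo (suc (n ∸ 2)))) (upTo (suc (n ∸ 2)))) (upTo (suc (n ∸ 2))))

size : ℕ → ℕ
size n = length (Tlist n)

elt : (n : ℕ) → Fin (size n) → ℕ³
elt n i = lookup (Tlist n) i

Cover : (n : ℕ) → List Color → Fin (size n) → Fin (size n) → Set
Cover n S i j = Σ Color λ x → x LM.∈ S × (toℤ³ (elt n j) ≡ toℤ³ (elt n i) +³ vec x)

Le : (n : ℕ) → List Color → Fin (size n) → Fin (size n) → Set
Le n S = Star (Cover n S)

LeDual : (n : ℕ) → List Color → Fin (size n) → Fin (size n) → Set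
LeDual n S = flip (Le n S)

IsIdeal : {m : ℕ} → (Fin m → Fin m → Set) → Subset m → Set
IsIdeal {m} _≤_ I = (i j : Fin m) → i ≤ j → j Sub.∈ I → i Sub.∈ I

IsIdealOfSize : {m : ℕ} → (Fin m → Fin m → Set) → ℕ → Subset m → Set
IsIdealOfSize _≤_ k I = IsIdeal _≤_ I × Sub.∣ I ∣ ≡ k

HasCard : {m : ℕ} → (Subset m → Set) → ℕ → Set
HasCard {m} P k =
  Σ (List (Subset m)) λ L →
    Unique L × length L ≡ k × ((I : Subset m) → (I LM.∈ L → P I) × (P I → I LM.∈ L))

-- Polynomials in q with ℕ coefficients, as coefficient lists (constant first)

Poly : Set
Poly = List ℕ

coeff : ℕ → Poly → ℕ
coeff _ [] = 0
coeff zero (a ∷ p) = a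
coeff (suc k) (a ∷ p) = coeff k p

_+ᴾ_ : Poly → Poly → Poly
[] +ᴾ q = q
(a ∷ p) +ᴾ [] = a ∷ p
(a ∷ p) +ᴾ (c ∷ q) = (a + c) ∷ (p +ᴾ q)

_*ᴾ_ : Poly → Poly → Poly
[] *ᴾ q = []
(a ∷ p) *ᴾ q = map (a *_) q +ᴾ (0 ∷ (p *ᴾ q))

oneᴾ : Poly
oneᴾ = 1 ∷ []

shift : ℕ → Poly → Poly
shift i p = replicate i 0 ++ p

sumᴾ : List Poly → Poly
sumᴾ = foldr _+ᴾ_ []

prodᴾ : List Poly → Poly
prodᴾ = foldr _*ᴾ_ oneᴾ

lastOr : {A : Set} → A → List A → A
lastOr d [] = d
lastOr d (x ∷ xs) = lastOr x xs

imap : {A B : Set} → (ℕ → A → B) → List A → List B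
imap f [] = []
imap f (x ∷ xs) = f 0 x ∷ imap (λ i → f (suc i)) xs

-- qCatsUpTo j = [C_0(q), ..., C_j(q)], via
--   C_{j+1}(q) = Σ_{k=1}^{j+1} q^{k-1} C_{k-1}(q) C_{j+1-k}(q)
qCatsUpTo : ℕ → List Poly
qCatsUpTo zero = oneᴾ ∷ []
qCatsUpTo (suc j) = L ++ (sumᴾ (imap shift (zipWith _*ᴾ_ L (reverse L))) ∷ [])
  where L = qCatsUpTo j

-- Carlitz–Riordan q-Catalan number C_j(q)
qCat : ℕ → Poly
qCat j = lastOr oneᴾ (qCatsUpTo j)

catsUpTo : ℕ → List ℕ
catsUpTo zero = 1 ∷ []
catsUpTo (suc j) = L ++ (foldr _+_ 0 (zipWith _*_ L (reverse L)) ∷ [])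
  where L = catsUpTo j

catalan : ℕ → ℕ
catalan j = lastOr 1 (catsUpTo j)

-- [a, a+1, ..., b]  (empty if b < a)
range : ℕ → ℕ → List ℕ
range a c = map (λ t → a + t) (upTo (suc c ∸ a))

prodℕ : List ℕ → ℕ
prodℕ = foldr _*_ 1

prodℚ : List ℚ → ℚ
prodℚ = foldr ℚ._*_ 1ℚ

-- a / c as a rational; only ever used with c ≠ 0 (c = 0 ↦ 0 is a dummy)
qdiv : ℕ → ℕ → ℚ
qdiv a zero = 0ℚ
qdiv a (suc c) = (+ a) ℚ./ suc c

prodCatalan : ℕ → ℕ
prodCatalan n = prodℕ (map catalan (range 1 n))

prodBinom : ℕ → ℚ
prodBinom n = prodℚ (map (λ j → qdiv 1 (j + 1) ℚ.* qdiv ((2 * j) C j) 1) (range 1 n))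

prodTriple : ℕ → ℚ
prodTriple n = prodℚ
  (concatMap (λ i → concatMap (λ j → map (λ k → qdiv (i + j + 2) (i + j))
     (range j (n ∸ 1))) (range i (n ∸ 1))) (range 1 (n ∸ 1)))

prodQCat : ℕ → Poly
prodQCat n = prodᴾ (map qCat (range 1 n))

S₁-choices : List (List Color)
S₁-choices = (b ∷ g ∷ []) ∷ (b ∷ s ∷ []) ∷ (y ∷ o ∷ []) ∷ (g ∷ s ∷ []) ∷ []

S₂-choices : List (List Color)
S₂-choices = (r ∷ y ∷ []) ∷ (r ∷ g ∷ []) ∷ (y ∷ g ∷ []) ∷ (b ∷ o ∷ []) ∷ []

module Submission where

-- Adding the slack c₀ = n - 2 - c₁ - c₂ - c₃ as a fourth coordinate, every colour moves one unit
-- from one of the four coordinates to another. For each choice of two colours, one coordinate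
-- never changes, so T_n splits into one layer for each of its values, and in every layer both
-- colours move a unit into a common coordinate, the height (for S₂, out of it, hence the dual).
-- A layer is thus the poset of positive roots of type A. An ideal of it is a sequence of column
-- heights with x₁ ≤ 1 and xᵢ₊₁ ≤ xᵢ + 1, and cutting such sequences at the first 0 yields the
-- Carlitz–Riordan recursion. Polynomials are handled as multisets of exponents, so that equality
-- of generating functions is a permutation of lists. Complementation of ideals removes the dual.
-- The closed form of C_j follows from its recursion by averaging over k ↦ j - k, and the factors
-- of the triple product with a fixed k telescope to C_{k+1}.

open import Defs
open import Data.Bool using (Bool; true; false; if_then_else_)
open import Data.Nat
  using (ℕ; zero; suc; _+_; _*_; _∸_; _≤_; _<_; _≡ᵇ_; _<ᵇ_; z≤n; s≤s; s≤s⁻¹; _≟_; _<?_; _≤?_)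
open import Data.Nat.Properties
open import Data.Nat.Combinatorics using (_C_; nCk+nC[k+1]≡[n+1]C[k+1]; nCk≡nC[n∸k]; nCn≡1)
open import Data.Nat.Induction using (<-rec)
open import Data.Nat.ListAction using (sum)
open import Data.Nat.Solver using (module +-*-Solver)
import Data.Integer as ℤ
import Data.Integer.Properties as ℤ
open import Data.Rational as ℚ using (ℚ; 1ℚ; _/_; fromℚᵘ; toℚᵘ)
import Data.Rational.Properties as ℚ
open import Data.Rational.Unnormalised as ℚᵘ using (mkℚᵘ; *≡*)
import Data.Rational.Unnormalised.Properties as ℚᵘ
open import Data.Fin as Fin using (Fin; zero; suc)
open import Data.Fin.Patterns using (0F; 1F; 2F; 3F)
open import Data.Fin.Permutation as Perm
  using (Permutation′; _⟨$⟩ʳ_; _⟨$⟩ˡ_; inverseˡ; inverseʳ; transpose; _∘ₚ_)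
open import Data.Fin.Properties using (any?)
open import Data.Fin.Subset as Sub using (Subset; ∁; ∣_∣)
open import Data.Fin.Subset.Properties
  using (_∈?_; ⊆-antisym; x∈p⇒x∉∁p; x∈∁p⇒x∉p; x∉∁p⇒x∈p; x∉p⇒x∈∁p)
open import Data.Product using (_×_; _,_; proj₁; proj₂; ∃)
open import Data.Product.Properties using (≡-dec)
open import Data.Sum as Sum using (_⊎_; inj₁; inj₂; [_,_]′)
open import Data.List
  using (List; []; _∷_; _++_; map; foldr; filter; length; replicate; zipWith; reverse; concatMap;
         lookup; cartesianProductWith; applyUpTo; applyDownFrom; upTo; tabulate)
open import Data.List.Properties hiding (≡-dec)
open import Data.List.Membership.Propositional using (_∈_)
open import Data.List.Membership.Propositional.Properties
open import Data.List.Membership.Propositional.Properties.WithK using (unique∧set⇒bag)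
open import Data.List.Relation.Unary.Any using (here; there; index)
open import Data.List.Relation.Unary.Any.Properties using (lookup-index)
open import Data.List.Relation.Unary.All as All using ([])
open import Data.List.Relation.Unary.AllPairs using ([]; _∷_)
open import Data.List.Relation.Unary.Unique.Propositional using (Unique)
import Data.List.Relation.Unary.Unique.Propositional.Properties as Unique
open import Data.List.Relation.Binary.BagAndSetEquality using (∼bag⇒↭)
open import Data.List.Relation.Binary.Permutation.Propositional as ↭
  using (_↭_; prep; swap; ↭-refl; ↭-sym; ↭-trans; ↭-reflexive; module PermutationReasoning)
open import Data.List.Relation.Binary.Permutation.Propositional.Properties as ↭
  using (++⁺; ++⁺ˡ; shifts; ↭-length; filter-↭)
import Data.Vec as Vec
import Data.Vec.Properties as Vec
open import Algebra.Bundles using (module AbelianGroup; module CommutativeMonoid)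
open import Algebra.Properties.CommutativeMonoid.Sum +-0-commutativeMonoid
  using (sum-cong-≗) renaming (sum to total; sum-permute to total-permute)
open import Algebra.Properties.CommutativeSemigroup using (interchange)
open import Algebra.Properties.Group (AbelianGroup.group ℤ.+-0-abelianGroup) using (∙-cancelʳ)
open import Function using (_∘_; _⇔_; mk⇔; Equivalence)
open import Relation.Binary.Construct.Closure.ReflexiveTransitive using (Star; ε; _◅_)
open import Relation.Binary.PropositionalEquality hiding ([_])
open import Relation.Nullary using (Dec; yes; does; ¬_; contradiction; _×-dec_)
open import Relation.Nullary.Decidable using (dec-true; does-⇔)

-- Generating functions as multisets of exponents

-- Coefficient lists are not canonical, because trailing zeros are allowed. A permutation of
-- exponent lists ignores them and still fixes every coefficient, and by length also the value at q
-- = 1, so one bijection gives both the q-count and the plain count. Put N = n - 2 and let layer m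
-- be the one whose constant coordinate is N - m. Its columns have 1, ..., m + 1 elements, and its
-- ideals are sequences of length m + 1 with x₁ ≤ 1; prefixing a 0 turns them into sequences of
-- length m + 2 starting at 0, the objects behind C_{m+2}(q). Layers 0, ..., N thus supply C_2, ...,
-- C_n, and C_1 = 1 completes the product. The recursion cannot be proved for sequences starting at
-- 0 alone: after an entry x the remainder may start as high as x + 1. Hence the bound h on the
-- first entry stays a parameter of the induction. Once the slack is added, the four coordinates
-- play symmetric roles, since only their total matters. All eight colour pairs are therefore one
-- count transported along a permutation of the coordinates, and within each of the two lists every
-- coordinate is the constant one exactly once.

++-interchange : {A : Set} (xs ys zs ws : List A) →
  (xs ++ ys) ++ (zs ++ ws) ↭ (xs ++ zs) ++ (ys ++ ws)
++-interchange = interchange (CommutativeMonoid.commutativeSemigroup ↭.++-commutativeMonoid)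

infixl 7 _⊕_

_⊕_ : List ℕ → List ℕ → List ℕ
_⊕_ = cartesianProductWith _+_

⊕-congʳ : ∀ xs {ys ys′} → ys ↭ ys′ → xs ⊕ ys ↭ xs ⊕ ys′
⊕-congʳ []       p = ↭-refl
⊕-congʳ (x ∷ xs) p = ++⁺ (↭.map⁺ (x +_) p) (⊕-congʳ xs p)

⊕-congˡ : ∀ {xs xs′} ys → xs ↭ xs′ → xs ⊕ ys ↭ xs′ ⊕ ys
⊕-congˡ ys ↭.refl          = ↭-refl
⊕-congˡ ys (prep x p)      = ++⁺ˡ (map (x +_) ys) (⊕-congˡ ys p)
⊕-congˡ ys (swap x z p)    = ↭-trans (shifts (map (x +_) ys) (map (z +_) ys))
  (++⁺ˡ (map (z +_) ys) (++⁺ˡ (map (x +_) ys) (⊕-congˡ ys p)))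
⊕-congˡ ys (↭.trans p₁ p₂) = ↭-trans (⊕-congˡ ys p₁) (⊕-congˡ ys p₂)

⊕-cong : ∀ {xs xs′ ys ys′} → xs ↭ xs′ → ys ↭ ys′ → xs ⊕ ys ↭ xs′ ⊕ ys′
⊕-cong {xs′ = xs′} {ys} p p′ = ↭-trans (⊕-congˡ ys p) (⊕-congʳ xs′ p′)

⊕-distribʳ-++ : ∀ xs ys zs → (xs ++ ys) ⊕ zs ≡ xs ⊕ zs ++ ys ⊕ zs
⊕-distribʳ-++ = cartesianProductWith-distribʳ-++ _+_

map-+-⊕ : ∀ c xs ys → map (c +_) xs ⊕ ys ≡ map (c +_) (xs ⊕ ys)
map-+-⊕ c []       ys = refl
map-+-⊕ c (x ∷ xs) ys = begin
  map (c + x +_) ys ++ map (c +_) xs ⊕ ys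
    ≡⟨ cong₂ _++_ (trans (map-cong (+-assoc c x) ys) (map-∘ ys)) (map-+-⊕ c xs ys) ⟩
  map (c +_) (map (x +_) ys) ++ map (c +_) (xs ⊕ ys)
    ≡⟨ map-++ (c +_) (map (x +_) ys) (xs ⊕ ys) ⟨
  map (c +_) (map (x +_) ys ++ xs ⊕ ys) ∎
  where open ≡-Reasoning

0-⊕ : ∀ xs → (0 ∷ []) ⊕ xs ≡ xs
0-⊕ xs = trans (++-identityʳ _) (map-id xs)

length-⊕ : ∀ xs ys → length (xs ⊕ ys) ≡ length xs * length ys
length-⊕ []       ys = refl
length-⊕ (x ∷ xs) ys = begin
  length (map (x +_) ys ++ xs ⊕ ys)         ≡⟨ length-++ (map (x +_) ys) ⟩
  length (map (x +_) ys) + length (xs ⊕ ys) ≡⟨ cong₂ _+_ (length-map (x +_) ys) (length-⊕ xs ys) ⟩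
  length ys + length xs * length ys         ∎
  where open ≡-Reasoning

map-cartesianProductWith : ∀ {A B C A′ B′ C′ : Set} {f : A → B → C} {f′ : A′ → B′ → C′}
  (u : A → A′) (v : B → B′) (w : C → C′) → (∀ x y → w (f x y) ≡ f′ (u x) (v y)) →
  ∀ xs ys → map w (cartesianProductWith f xs ys) ≡ cartesianProductWith f′ (map u xs) (map v ys)
map-cartesianProductWith u v w eq []       ys = refl
map-cartesianProductWith {f = f} {f′} u v w eq (x ∷ xs) ys = begin
  map w (map (f x) ys ++ cartesianProductWith f xs ys)
    ≡⟨ map-++ w (map (f x) ys) _ ⟩
  map w (map (f x) ys) ++ map w (cartesianProductWith f xs ys)
    ≡⟨ cong₂ _++_ (trans (sym (map-∘ ys)) (trans (map-cong (eq x) ys) (map-∘ ys)))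
                  (map-cartesianProductWith u v w eq xs ys) ⟩
  map (f′ (u x)) (map v ys) ++ cartesianProductWith f′ (map u xs) (map v ys) ∎
  where open ≡-Reasoning

-- The exponents of the monomials of p, each repeated as often as its coefficient says.
exponents : Poly → List ℕ
exponents []      = []
exponents (a ∷ p) = replicate a 0 ++ map suc (exponents p)

count : ℕ → List ℕ → ℕ
count k = length ∘ filter (_≟ k)

count-++ : ∀ k xs ys → count k (xs ++ ys) ≡ count k xs + count k ys
count-++ k xs ys = trans (cong length (filter-++ (_≟ k) xs ys)) (length-++ (filter (_≟ k) xs))

count-replicate-0 : ∀ a → count 0 (replicate a 0) ≡ a
count-replicate-0 zero    = refl
count-replicate-0 (suc a) = cong suc (count-replicate-0 a)

count-suc-replicate-0 : ∀ k a → count (suc k) (replicate a 0) ≡ 0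
count-suc-replicate-0 k zero    = refl
count-suc-replicate-0 k (suc a) = count-suc-replicate-0 k a

count-0-map-suc : ∀ xs → count 0 (map suc xs) ≡ 0
count-0-map-suc []       = refl
count-0-map-suc (x ∷ xs) = count-0-map-suc xs

count-map-suc : ∀ k xs → count (suc k) (map suc xs) ≡ count k xs
count-map-suc k []       = refl
count-map-suc k (x ∷ xs) with x ≡ᵇ k
... | true  = cong suc (count-map-suc k xs)
... | false = count-map-suc k xs

-- The bridge to the statement: permuted exponent lists have equal counts, so the corresponding
-- coefficients agree whatever the lengths of the coefficient lists.
coeff-count : ∀ k p → coeff k p ≡ count k (exponents p)
coeff-count k       []      = refl
coeff-count zero    (a ∷ p) = sym (begin
  count 0 (replicate a 0 ++ map suc (exponents p))
    ≡⟨ count-++ 0 (replicate a 0) _ ⟩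
  count 0 (replicate a 0) + count 0 (map suc (exponents p))
    ≡⟨ cong₂ _+_ (count-replicate-0 a) (count-0-map-suc (exponents p)) ⟩
  a + 0
    ≡⟨ +-identityʳ a ⟩
  a ∎)
  where open ≡-Reasoning
coeff-count (suc k) (a ∷ p) = sym (begin
  count (suc k) (replicate a 0 ++ map suc (exponents p))
    ≡⟨ count-++ (suc k) (replicate a 0) _ ⟩
  count (suc k) (replicate a 0) + count (suc k) (map suc (exponents p))
    ≡⟨ cong₂ _+_ (count-suc-replicate-0 k a) (count-map-suc k (exponents p)) ⟩
  count k (exponents p)
    ≡⟨ coeff-count k p ⟨
  coeff k p ∎)
  where open ≡-Reasoning

exponents-+ᴾ : ∀ p q → exponents (p +ᴾ q) ↭ exponents p ++ exponents q
exponents-+ᴾ []      q       = ↭-refl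
exponents-+ᴾ (a ∷ p) []      = ↭-reflexive (sym (++-identityʳ _))
exponents-+ᴾ (a ∷ p) (c ∷ q) = begin
  replicate (a + c) 0 ++ map suc (exponents (p +ᴾ q))
    ↭⟨ ++⁺ (↭-reflexive (replicate-+ a c)) (↭.map⁺ suc (exponents-+ᴾ p q)) ⟩
  (replicate a 0 ++ replicate c 0) ++ map suc (exponents p ++ exponents q)
    ≡⟨ cong ((replicate a 0 ++ replicate c 0) ++_) (map-++ suc (exponents p) (exponents q)) ⟩
  (replicate a 0 ++ replicate c 0) ++ (map suc (exponents p) ++ map suc (exponents q))
    ↭⟨ ++-interchange (replicate a 0) _ _ _ ⟩
  (replicate a 0 ++ map suc (exponents p)) ++ (replicate c 0 ++ map suc (exponents q)) ∎
  where
  open PermutationReasoning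
  replicate-+ : ∀ a c → replicate (a + c) 0 ≡ replicate a 0 ++ replicate c 0
  replicate-+ zero    c = refl
  replicate-+ (suc a) c = cong (0 ∷_) (replicate-+ a c)

-- `replicate a 0` is the multiset of exponents of the constant polynomial a, so scaling becomes an
-- instance of `_⊕_`.
exponents-scale : ∀ a q → exponents (map (a *_) q) ↭ replicate a 0 ⊕ exponents q
exponents-scale zero    []      = ↭-refl
exponents-scale zero    (c ∷ q) = ↭.map⁺ suc (exponents-scale zero q)
exponents-scale (suc a) q = begin
  exponents (map (suc a *_) q)
    ≡⟨ cong exponents (scale-suc q) ⟩
  exponents (q +ᴾ map (a *_) q)
    ↭⟨ exponents-+ᴾ q _ ⟩
  exponents q ++ exponents (map (a *_) q)
    ↭⟨ ++⁺ (↭-reflexive (sym (map-id (exponents q)))) (exponents-scale a q) ⟩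
  map (0 +_) (exponents q) ++ replicate a 0 ⊕ exponents q ∎
  where
  open PermutationReasoning
  scale-suc : ∀ q → map (suc a *_) q ≡ q +ᴾ map (a *_) q
  scale-suc []      = refl
  scale-suc (c ∷ q) = cong (c + a * c ∷_) (scale-suc q)

exponents-*ᴾ : ∀ p q → exponents (p *ᴾ q) ↭ exponents p ⊕ exponents q
exponents-*ᴾ []      q = ↭-refl
exponents-*ᴾ (a ∷ p) q = begin
  exponents (map (a *_) q +ᴾ (0 ∷ (p *ᴾ q)))
    ↭⟨ exponents-+ᴾ (map (a *_) q) _ ⟩
  exponents (map (a *_) q) ++ map suc (exponents (p *ᴾ q))
    ↭⟨ ++⁺ (exponents-scale a q) (↭.map⁺ suc (exponents-*ᴾ p q)) ⟩
  replicate a 0 ⊕ exponents q ++ map suc (exponents p ⊕ exponents q)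
    ≡⟨ cong (replicate a 0 ⊕ exponents q ++_) (map-+-⊕ 1 (exponents p) (exponents q)) ⟨
  replicate a 0 ⊕ exponents q ++ map suc (exponents p) ⊕ exponents q
    ≡⟨ ⊕-distribʳ-++ (replicate a 0) _ _ ⟨
  (replicate a 0 ++ map suc (exponents p)) ⊕ exponents q ∎
  where open PermutationReasoning

-- Catalan recursions as convolutions

module History {A : Set} (d : A) (next : List A → A) (table : ℕ → List A)
  (table-zero : table 0 ≡ d ∷ [])
  (table-suc : ∀ j → table (suc j) ≡ table j ++ next (table j) ∷ []) where

  entry : ℕ → A
  entry j = lastOr d (table j)

  private
    lastOr-++ : ∀ d xs (x : A) → lastOr d (xs ++ x ∷ []) ≡ x
    lastOr-++ d []       x = refl
    lastOr-++ d (_ ∷ xs) x = lastOr-++ _ xs x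

    entry-next : ∀ j → entry (suc j) ≡ next (table j)
    entry-next j = trans (cong (lastOr d) (table-suc j)) (lastOr-++ d (table j) _)

  -- Appending never alters earlier entries, so the list consulted at stage j consists of the
  -- numbers themselves. This turns the tabulated definitions of both Catalan families into
  -- course-of-values recursions.
  table-applyUpTo : ∀ j → table j ≡ applyUpTo entry (suc j)
  table-applyUpTo zero    = trans table-zero (cong (_∷ []) (sym (cong (lastOr d) table-zero)))
  table-applyUpTo (suc j) = begin
    table (suc j)                              ≡⟨ table-suc j ⟩
    table j ++ next (table j) ∷ []             ≡⟨ cong₂ (λ xs x → xs ++ x ∷ []) (table-applyUpTo j)
                                                        (sym (entry-next j)) ⟩
    applyUpTo entry (suc j) ++ entry (suc j) ∷ [] ≡⟨ applyUpTo-∷ʳ entry (suc j) ⟩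
    applyUpTo entry (suc (suc j))              ∎
    where open ≡-Reasoning

  entry-suc : ∀ j → entry (suc j) ≡ next (applyUpTo entry (suc j))
  entry-suc j = trans (entry-next j) (cong next (table-applyUpTo j))

qCat-suc : ∀ j → qCat (suc j) ≡
  sumᴾ (imap shift (zipWith _*ᴾ_ (applyUpTo qCat (suc j)) (applyDownFrom qCat (suc j))))
qCat-suc j = trans
  (History.entry-suc oneᴾ (λ L → sumᴾ (imap shift (zipWith _*ᴾ_ L (reverse L)))) qCatsUpTo
    refl (λ _ → refl) j)
  (cong (λ L → sumᴾ (imap shift (zipWith _*ᴾ_ (applyUpTo qCat (suc j)) L)))
    (reverse-applyUpTo qCat (suc j)))

catalan-suc : ∀ j → catalan (suc j) ≡
  sum (zipWith _*_ (applyUpTo catalan (suc j)) (applyDownFrom catalan (suc j)))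
catalan-suc j = trans
  (History.entry-suc 1 (λ L → foldr _+_ 0 (zipWith _*_ L (reverse L))) catsUpTo
    refl (λ _ → refl) j)
  (cong (λ L → sum (zipWith _*_ (applyUpTo catalan (suc j)) L)) (reverse-applyUpTo catalan (suc j)))

-- The exponents of Σ_{k<n} q^k A_k B_{n-1-k}, for multisets A_k and B_k of exponents.
conv : (A B : ℕ → List ℕ) → ℕ → List ℕ
conv A B zero    = []
conv A B (suc n) = A 0 ⊕ B n ++ map suc (conv (A ∘ suc) B n)

conv-cong : ∀ {A A′ B B′} n → (∀ k → k < n → A k ↭ A′ k) → (∀ k → k < n → B k ↭ B′ k) →
  conv A B n ↭ conv A′ B′ n
conv-cong zero    A↭A′ B↭B′ = ↭-refl
conv-cong (suc n) A↭A′ B↭B′ = ++⁺ (⊕-cong (A↭A′ 0 (s≤s z≤n)) (B↭B′ n ≤-refl))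
  (↭.map⁺ suc (conv-cong n (λ k k<n → A↭A′ (suc k) (s≤s k<n)) (λ k k<n → B↭B′ k (m<n⇒m<1+n k<n))))

-- Linearity in the first factor, where `map (c +_)` is multiplication by q^c. Splitting sequences
-- by whether the first entry attains its bound produces sums of this form.
conv-linear : ∀ c A A′ B n →
  conv (λ k → A k ++ map (c +_) (A′ k)) B n ↭ conv A B n ++ map (c +_) (conv A′ B n)
conv-linear c A A′ B zero    = ↭-refl
conv-linear c A A′ B (suc n) = begin
  (A 0 ++ map (c +_) (A′ 0)) ⊕ B n ++ map suc (conv (λ k → A (suc k) ++ map (c +_) (A′ (suc k))) B n)
    ↭⟨ ++⁺ (↭-reflexive head-eq) (↭.map⁺ suc (conv-linear c (A ∘ suc) (A′ ∘ suc) B n)) ⟩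
  (A 0 ⊕ B n ++ map (c +_) (A′ 0 ⊕ B n)) ++ map suc (rest ++ map (c +_) rest′)
    ≡⟨ cong ((A 0 ⊕ B n ++ map (c +_) (A′ 0 ⊕ B n)) ++_) tail-eq ⟩
  (A 0 ⊕ B n ++ map (c +_) (A′ 0 ⊕ B n)) ++ (map suc rest ++ map (c +_) (map suc rest′))
    ↭⟨ ++-interchange (A 0 ⊕ B n) _ _ _ ⟩
  (A 0 ⊕ B n ++ map suc rest) ++ (map (c +_) (A′ 0 ⊕ B n) ++ map (c +_) (map suc rest′))
    ≡⟨ cong ((A 0 ⊕ B n ++ map suc rest) ++_) (map-++ (c +_) (A′ 0 ⊕ B n) _) ⟨
  (A 0 ⊕ B n ++ map suc rest) ++ map (c +_) (A′ 0 ⊕ B n ++ map suc rest′) ∎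
  where
  open PermutationReasoning
  rest  = conv (A ∘ suc) B n
  rest′ = conv (A′ ∘ suc) B n
  head-eq : (A 0 ++ map (c +_) (A′ 0)) ⊕ B n ≡ A 0 ⊕ B n ++ map (c +_) (A′ 0 ⊕ B n)
  head-eq = trans (⊕-distribʳ-++ (A 0) _ (B n)) (cong (A 0 ⊕ B n ++_) (map-+-⊕ c (A′ 0) (B n)))
  tail-eq : map suc (rest ++ map (c +_) rest′) ≡ map suc rest ++ map (c +_) (map suc rest′)
  tail-eq = trans (map-++ suc rest _) (cong (map suc rest ++_)
    (trans (sym (map-∘ rest′)) (trans (map-cong (λ x → sym (+-suc c x)) rest′) (map-∘ rest′))))

-- One more 0 in front of every summand multiplies the sum by q. The shift is a general `f` because
-- `imap` hands `f ∘ suc` to the tail.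
exponents-sum-0∷ : ∀ (f : ℕ → Poly → Poly) ps →
  exponents (sumᴾ (imap (λ i p → 0 ∷ f i p) ps)) ↭ map suc (exponents (sumᴾ (imap f ps)))
exponents-sum-0∷ f []       = ↭-refl
exponents-sum-0∷ f (p ∷ ps) = begin
  exponents ((0 ∷ f 0 p) +ᴾ sumᴾ (imap (λ i p → 0 ∷ f (suc i) p) ps))
    ↭⟨ exponents-+ᴾ (0 ∷ f 0 p) (sumᴾ (imap (λ i p → 0 ∷ f (suc i) p) ps)) ⟩
  map suc (exponents (f 0 p)) ++ exponents (sumᴾ (imap (λ i p → 0 ∷ f (suc i) p) ps))
    ↭⟨ ++⁺ˡ (map suc (exponents (f 0 p))) (exponents-sum-0∷ (f ∘ suc) ps) ⟩
  map suc (exponents (f 0 p)) ++ map suc (exponents (sumᴾ (imap (f ∘ suc) ps)))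
    ≡⟨ map-++ suc (exponents (f 0 p)) _ ⟨
  map suc (exponents (f 0 p) ++ exponents (sumᴾ (imap (f ∘ suc) ps)))
    ↭⟨ ↭.map⁺ suc (exponents-+ᴾ (f 0 p) _) ⟨
  map suc (exponents (f 0 p +ᴾ sumᴾ (imap (f ∘ suc) ps))) ∎
  where open PermutationReasoning

exponents-conv : ∀ (u v : ℕ → Poly) n →
  exponents (sumᴾ (imap shift (zipWith _*ᴾ_ (applyUpTo u n) (applyDownFrom v n)))) ↭
  conv (exponents ∘ u) (exponents ∘ v) n
exponents-conv u v zero    = ↭-refl
exponents-conv u v (suc n) = ↭-trans (exponents-+ᴾ (u 0 *ᴾ v n) _)
  (++⁺ (exponents-*ᴾ (u 0) (v n)) (↭-trans
    (exponents-sum-0∷ shift (zipWith _*ᴾ_ (applyUpTo (u ∘ suc) n) (applyDownFrom v n)))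
    (↭.map⁺ suc (exponents-conv (u ∘ suc) v n))))

-- The sequences of length j with x₁ ≤ h and xᵢ₊₁ ≤ xᵢ + 1.
staircases : ℕ → ℕ → List (List ℕ)
staircases h       zero    = [] ∷ []
staircases zero    (suc j) = map (0 ∷_) (staircases 1 j)
staircases (suc h) (suc j) = staircases h (suc j) ++ map (suc h ∷_) (staircases (suc (suc h)) j)

areas : ℕ → ℕ → List ℕ
areas h j = map sum (staircases h j)

private
  map-sum-∷ : ∀ x xss → map sum (map (x ∷_) xss) ≡ map (x +_) (map sum xss)
  map-sum-∷ x xss = trans (sym (map-∘ xss)) (map-∘ xss)

areas-0-suc : ∀ j → areas 0 (suc j) ≡ areas 1 j
areas-0-suc j = trans (map-sum-∷ 0 (staircases 1 j)) (map-id _)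

areas-suc-suc : ∀ h j → areas (suc h) (suc j) ≡ areas h (suc j) ++ map (suc h +_) (areas (2 + h) j)
areas-suc-suc h j = trans (map-++ sum (staircases h (suc j)) _)
  (cong (areas h (suc j) ++_) (map-sum-∷ (suc h) (staircases (2 + h) j)))

-- A sequence starting at height at most h + 1 is cut just before it first reaches 0: lowering
-- the part before the cut by 1 gives a sequence starting at height at most h.
areas-conv : ∀ h j → areas (suc h) j ↭ conv (areas h) (areas 0) (suc j)
areas-conv h       zero    = ↭-refl
areas-conv zero    (suc j) = begin
  areas 1 (suc j)
    ≡⟨ areas-suc-suc 0 j ⟩
  areas 0 (suc j) ++ map suc (areas 2 j)
    -- A sequence starting with 0 has an empty part before the cut, which is the term k = 0. In the
    -- other terms `areas 1 k` is read as `areas 0 (suc k)`, the first entry 1 having been lowered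
    -- to a leading 0.
    ↭⟨ ++⁺ (↭-reflexive (sym (0-⊕ (areas 0 (suc j))))) (↭.map⁺ suc (↭-trans (areas-conv 1 j)
      (conv-cong (suc j) (λ k _ → ↭-reflexive (sym (areas-0-suc k))) (λ _ _ → ↭-refl)))) ⟩
  (0 ∷ []) ⊕ areas 0 (suc j) ++ map suc (conv (areas 0 ∘ suc) (areas 0) (suc j)) ∎
  where open PermutationReasoning
areas-conv (suc h) (suc j) = begin
  areas (2 + h) (suc j)
    ≡⟨ areas-suc-suc (suc h) j ⟩
  areas (suc h) (suc j) ++ map (2 + h +_) (areas (3 + h) j)
    -- Two induction hypotheses: a smaller bound at the same length when the first entry is at most
    -- h + 1, and a larger bound at a smaller length when it equals h + 2.
    ↭⟨ ++⁺ (areas-conv h (suc j)) (↭.map⁺ (2 + h +_) (areas-conv (2 + h) j)) ⟩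
  ((0 ∷ []) ⊕ areas 0 (suc j) ++ map suc lower) ++ map (2 + h +_) upper
    ≡⟨ ++-assoc ((0 ∷ []) ⊕ areas 0 (suc j)) _ _ ⟩
  (0 ∷ []) ⊕ areas 0 (suc j) ++ (map suc lower ++ map (2 + h +_) upper)
    ≡⟨ cong ((0 ∷ []) ⊕ areas 0 (suc j) ++_) (trans
         (cong (map suc lower ++_) (map-∘ upper)) (sym (map-++ suc lower _))) ⟩
  (0 ∷ []) ⊕ areas 0 (suc j) ++ map suc (lower ++ map (suc h +_) upper)
    ↭⟨ ++⁺ˡ ((0 ∷ []) ⊕ areas 0 (suc j)) (↭.map⁺ suc
         (conv-linear (suc h) (areas h ∘ suc) (areas (2 + h)) (areas 0) (suc j))) ⟨
  (0 ∷ []) ⊕ areas 0 (suc j) ++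
    map suc (conv (λ k → areas h (suc k) ++ map (suc h +_) (areas (2 + h) k)) (areas 0) (suc j))
    ↭⟨ ++⁺ˡ ((0 ∷ []) ⊕ areas 0 (suc j)) (↭.map⁺ suc (conv-cong (suc j)
         (λ k _ → ↭-reflexive (areas-suc-suc h k)) (λ _ _ → ↭-refl))) ⟨
  (0 ∷ []) ⊕ areas 0 (suc j) ++ map suc (conv (areas (suc h) ∘ suc) (areas 0) (suc j)) ∎
  where
  open PermutationReasoning
  lower = conv (areas h ∘ suc) (areas 0) (suc j)
  upper = conv (areas (2 + h)) (areas 0) (suc j)

qCat-areas : ∀ j → exponents (qCat j) ↭ areas 0 j
qCat-areas = <-rec _ step
  where
  open PermutationReasoning
  step : ∀ j → (∀ {i} → i < j → exponents (qCat i) ↭ areas 0 i) → exponents (qCat j) ↭ areas 0 j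
  step zero    ih = ↭-refl
  step (suc j) ih = begin
    exponents (qCat (suc j))
      ≡⟨ cong exponents (qCat-suc j) ⟩
    exponents (sumᴾ (imap shift (zipWith _*ᴾ_ (applyUpTo qCat (suc j)) (applyDownFrom qCat (suc j)))))
      ↭⟨ exponents-conv qCat qCat (suc j) ⟩
    conv (exponents ∘ qCat) (exponents ∘ qCat) (suc j)
      ↭⟨ conv-cong (suc j) (λ _ k<j → ih k<j) (λ _ k<j → ih k<j) ⟩
    conv (areas 0) (areas 0) (suc j)
      -- At h = 0 both factors of the convolution are `areas 0`, which makes the cut the
      -- Carlitz-Riordan recursion itself.
      ↭⟨ areas-conv 0 j ⟨
    areas 1 j
      ≡⟨ areas-0-suc j ⟨
    areas 0 (suc j) ∎

-- Evaluation at q = 1 and products over the layers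

length-exponents-*ᴾ : ∀ p q → length (exponents (p *ᴾ q)) ≡ length (exponents p) * length (exponents q)
length-exponents-*ᴾ p q =
  trans (↭-length (exponents-*ᴾ p q)) (length-⊕ (exponents p) (exponents q))

length-conv : ∀ {A B} n → length (conv A B n) ≡
  sum (zipWith _*_ (applyUpTo (length ∘ A) n) (applyDownFrom (length ∘ B) n))
length-conv         zero    = refl
length-conv {A} {B} (suc n) = trans (length-++ (A 0 ⊕ B n))
  (cong₂ _+_ (length-⊕ (A 0) (B n))
    (trans (length-map suc (conv (A ∘ suc) B n)) (length-conv n)))

-- The number of exponents is the value at q = 1, where the Carlitz-Riordan recursion loses its
-- powers of q and becomes the Catalan recursion.
catalan-length : ∀ j → catalan j ≡ length (exponents (qCat j))
catalan-length = <-rec _ step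
  where
  open ≡-Reasoning
  conv-≡ : ∀ {u u′ v v′ : ℕ → ℕ} n → (∀ k → k < n → u k ≡ u′ k) → (∀ k → k < n → v k ≡ v′ k) →
    sum (zipWith _*_ (applyUpTo u n) (applyDownFrom v n)) ≡
    sum (zipWith _*_ (applyUpTo u′ n) (applyDownFrom v′ n))
  conv-≡ zero    u≡ v≡ = refl
  conv-≡ (suc n) u≡ v≡ = cong₂ _+_ (cong₂ _*_ (u≡ 0 (s≤s z≤n)) (v≡ n ≤-refl))
    (conv-≡ n (λ k k<n → u≡ (suc k) (s≤s k<n)) (λ k k<n → v≡ k (m<n⇒m<1+n k<n)))
  step : ∀ j → (∀ {i} → i < j → catalan i ≡ length (exponents (qCat i))) →
    catalan j ≡ length (exponents (qCat j))
  step zero    ih = refl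
  step (suc j) ih = begin
    catalan (suc j)
      ≡⟨ catalan-suc j ⟩
    sum (zipWith _*_ (applyUpTo catalan (suc j)) (applyDownFrom catalan (suc j)))
      ≡⟨ conv-≡ (suc j) (λ _ k<j → ih k<j) (λ _ k<j → ih k<j) ⟩
    sum (zipWith _*_ (applyUpTo (length ∘ exponents ∘ qCat) (suc j))
                     (applyDownFrom (length ∘ exponents ∘ qCat) (suc j)))
      ≡⟨ length-conv {exponents ∘ qCat} {exponents ∘ qCat} (suc j) ⟨
    length (conv (exponents ∘ qCat) (exponents ∘ qCat) (suc j))
      ≡⟨ ↭-length (exponents-conv qCat qCat (suc j)) ⟨
    length (exponents (sumᴾ (imap shift
      (zipWith _*ᴾ_ (applyUpTo qCat (suc j)) (applyDownFrom qCat (suc j))))))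
      ≡⟨ cong (length ∘ exponents) (qCat-suc j) ⟨
    length (exponents (qCat (suc j))) ∎

length-exponents-prod : ∀ ks → length (exponents (prodᴾ (map qCat ks))) ≡ prodℕ (map catalan ks)
length-exponents-prod []       = refl
length-exponents-prod (k ∷ ks) = trans (length-exponents-*ᴾ (qCat k) _)
  (cong₂ _*_ (sym (catalan-length k)) (length-exponents-prod ks))

-- Codes for the ideals of the k consecutive layers from m on: layer m has m + 1 columns, and the
-- layers are chosen independently because no covering relation joins two of them.
profiles : ℕ → ℕ → List (List (List ℕ))
profiles m zero    = [] ∷ []
profiles m (suc k) = cartesianProductWith _∷_ (staircases 1 (suc m)) (profiles (suc m) k)

area : List (List ℕ) → ℕ
area = sum ∘ map sum

-- Independent choices multiply generating functions. Layer m contributes C_{m+2}(q): its m + 1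
-- columns become m + 2 after a leading 0 is added.
profiles-areas : ∀ m k → map area (profiles m k) ↭ exponents (prodᴾ (applyUpTo (λ t → qCat (2 + (t + m))) k))
profiles-areas m zero    = ↭-refl
profiles-areas m (suc k) = begin
  map area (cartesianProductWith _∷_ (staircases 1 (suc m)) (profiles (suc m) k))
    ≡⟨ map-cartesianProductWith sum area area (λ _ _ → refl) (staircases 1 (suc m)) _ ⟩
  areas 1 (suc m) ⊕ map area (profiles (suc m) k)
    ↭⟨ ⊕-cong (↭-trans (↭-reflexive (sym (areas-0-suc (suc m)))) (↭-sym (qCat-areas (2 + m))))
              (profiles-areas (suc m) k) ⟩
  exponents (qCat (2 + m)) ⊕ exponents (prodᴾ (applyUpTo (λ t → qCat (2 + (t + suc m))) k))
    ≡⟨ cong (λ L → exponents (qCat (2 + m)) ⊕ exponents (prodᴾ L)) (applyUpTo-cong k) ⟩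
  exponents (qCat (2 + m)) ⊕ exponents (prodᴾ (applyUpTo (λ t → qCat (2 + (suc t + m))) k))
    ↭⟨ exponents-*ᴾ (qCat (2 + m)) _ ⟨
  exponents (qCat (2 + m) *ᴾ prodᴾ (applyUpTo (λ t → qCat (2 + (suc t + m))) k)) ∎
  where
  open PermutationReasoning
  applyUpTo-cong : ∀ k → applyUpTo (λ t → qCat (2 + (t + suc m))) k ≡ applyUpTo (λ t → qCat (2 + (suc t + m))) k
  applyUpTo-cong k = trans (sym (map-upTo _ k)) (trans
    (map-cong (λ t → cong (λ i → qCat (2 + i)) (+-suc t m)) (upTo k)) (map-upTo _ k))

range-1 : ∀ N → range 1 (2 + N) ≡ 1 ∷ applyUpTo (2 +_) (suc N)
range-1 N = map-upTo suc (2 + N)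

profiles-prodQCat : ∀ N → map area (profiles 0 (suc N)) ↭ exponents (prodQCat (2 + N))
profiles-prodQCat N = begin
  map area (profiles 0 (suc N))
    ↭⟨ profiles-areas 0 (suc N) ⟩
  exponents (prodᴾ (applyUpTo (λ t → qCat (2 + (t + 0))) (suc N)))
    ≡⟨ cong (exponents ∘ prodᴾ) layers ⟩
  exponents (prodᴾ (map qCat (applyUpTo (2 +_) (suc N))))
    -- The factor C_1(q) = 1 belongs to no layer; its exponents compute to `0 ∷ []`, the unit of
    -- `_⊕_`.
    ≡⟨ 0-⊕ _ ⟨
  (0 ∷ []) ⊕ exponents (prodᴾ (map qCat (applyUpTo (2 +_) (suc N))))
    ↭⟨ exponents-*ᴾ (qCat 1) (prodᴾ (map qCat (applyUpTo (2 +_) (suc N)))) ⟨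
  exponents (prodᴾ (map qCat (1 ∷ applyUpTo (2 +_) (suc N))))
    ≡⟨ cong (exponents ∘ prodᴾ ∘ map qCat) (range-1 N) ⟨
  exponents (prodQCat (2 + N)) ∎
  where
  open PermutationReasoning
  layers : applyUpTo (λ t → qCat (2 + (t + 0))) (suc N) ≡ map qCat (applyUpTo (2 +_) (suc N))
  layers = trans (sym (map-upTo _ (suc N)))
    (trans (map-cong (λ t → cong (λ i → qCat (2 + i)) (+-identityʳ t)) (upTo (suc N)))
      (trans (map-upTo _ (suc N)) (sym (map-applyUpTo (2 +_) qCat (suc N)))))

-- Column heights and lower sets

applyUpTo-cong : ∀ {A : Set} {u v : ℕ → A} n → (∀ i → i < n → u i ≡ v i) → applyUpTo u n ≡ applyUpTo v n
applyUpTo-cong zero    eq = refl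
applyUpTo-cong (suc n) eq = cong₂ _∷_ (eq 0 (s≤s z≤n)) (applyUpTo-cong n (λ i i<n → eq (suc i) (s≤s i<n)))

-- With default 0 for heights, the inequality between neighbouring columns also holds at and past
-- the end of a row, so it needs no range condition.
at : {A : Set} → A → List A → ℕ → A
at d []       i       = d
at d (x ∷ xs) zero    = x
at d (x ∷ xs) (suc i) = at d xs i

at-applyUpTo : ∀ {A : Set} (d : A) u {n i} → i < n → at d (applyUpTo u n) i ≡ u i
at-applyUpTo d u {suc n} {zero}  i<n       = refl
at-applyUpTo d u {suc n} {suc i} (s≤s i<n) = at-applyUpTo d (u ∘ suc) i<n

data IsStaircase : ℕ → ℕ → List ℕ → Set where
  []  : ∀ {h} → IsStaircase h 0 []
  _∷_ : ∀ {h j x xs} → x ≤ h → IsStaircase (suc x) j xs → IsStaircase h (suc j) (x ∷ xs)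

staircase-weaken : ∀ {h j xs} → IsStaircase h j xs → IsStaircase (suc h) j xs
staircase-weaken []        = []
staircase-weaken (x≤h ∷ p) = m≤n⇒m≤1+n x≤h ∷ p

∈-staircases⁻ : ∀ h j {xs} → xs ∈ staircases h j → IsStaircase h j xs
∈-staircases⁻ h       zero    (here refl) = []
∈-staircases⁻ zero    (suc j) p with ∈-map⁻ (0 ∷_) p
... | _ , q , refl = z≤n ∷ ∈-staircases⁻ 1 j q
∈-staircases⁻ (suc h) (suc j) p with ∈-++⁻ (staircases h (suc j)) p
... | inj₁ q = staircase-weaken (∈-staircases⁻ h (suc j) q)
... | inj₂ q with ∈-map⁻ (suc h ∷_) q
... | _ , q′ , refl = ≤-refl ∷ ∈-staircases⁻ (2 + h) j q′

∷-∈-staircases : ∀ {h j x xs} → x ≤ h → xs ∈ staircases (suc x) j → (x ∷ xs) ∈ staircases h (suc j)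
∷-∈-staircases {zero}      z≤n p = ∈-map⁺ (0 ∷_) p
∷-∈-staircases {suc h} {j} x≤h p with m≤n⇒m<n∨m≡n x≤h
... | inj₁ x<h  = ∈-++⁺ˡ (∷-∈-staircases (s≤s⁻¹ x<h) p)
... | inj₂ refl = ∈-++⁺ʳ (staircases h (suc j)) (∈-map⁺ (suc h ∷_) p)

∈-staircases⁺ : ∀ {h j xs} → IsStaircase h j xs → xs ∈ staircases h j
∈-staircases⁺ []        = here refl
∈-staircases⁺ (x≤h ∷ p) = ∷-∈-staircases x≤h (∈-staircases⁺ p)

staircases-unique : ∀ h j → Unique (staircases h j)
staircases-unique h       zero    = [] ∷ []
staircases-unique zero    (suc j) = Unique.map⁺ ∷-injectiveʳ (staircases-unique 1 j)
staircases-unique (suc h) (suc j) = Unique.++⁺ (staircases-unique h (suc j))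
  (Unique.map⁺ ∷-injectiveʳ (staircases-unique (2 + h) j)) disjoint
  where
  disjoint : ∀ {xs} → ¬ (xs ∈ staircases h (suc j) × xs ∈ map (suc h ∷_) (staircases (2 + h) j))
  disjoint (p , q) with ∈-map⁻ (suc h ∷_) q
  ... | _ , _ , refl with ∈-staircases⁻ h (suc j) p
  ... | h<h ∷ _ = 1+n≰n h<h

staircase-applyUpTo⁺ : ∀ u {h} j → (0 < j → u 0 ≤ h) → (∀ i → suc i < j → u (suc i) ≤ suc (u i)) →
  IsStaircase h j (applyUpTo u j)
staircase-applyUpTo⁺ u zero    u₀ uₛ = []
staircase-applyUpTo⁺ u (suc j) u₀ uₛ = u₀ (s≤s z≤n) ∷
  staircase-applyUpTo⁺ (u ∘ suc) j (λ 0<j → uₛ 0 (s≤s 0<j)) (λ i i<j → uₛ (suc i) (s≤s i<j))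

staircase-applyUpTo⁻ : ∀ {h j xs} → IsStaircase h j xs → xs ≡ applyUpTo (at 0 xs) j
staircase-applyUpTo⁻ []      = refl
staircase-applyUpTo⁻ (_ ∷ p) = cong (_ ∷_) (staircase-applyUpTo⁻ p)

staircase-step : ∀ {h j xs} → IsStaircase h j xs → ∀ i → at 0 xs (suc i) ≤ suc (at 0 xs i)
staircase-step []                i       = z≤n
staircase-step (_ ∷ [])          i       = z≤n
staircase-step (_ ∷ (x≤h ∷ _))   zero    = x≤h
staircase-step (_ ∷ p@(_ ∷ _))   (suc i) = staircase-step p i

-- For h = 1 this says that column i is never asked for more than the i + 1 elements it has; the
-- steps enforce it, so it is not a separate condition on codes.
staircase-bound : ∀ {h j xs} → IsStaircase h j xs → ∀ i → at 0 xs i ≤ h + i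
staircase-bound []            i       = z≤n
staircase-bound (x≤h ∷ p)     zero    = ≤-trans x≤h (m≤m+n _ 0)
staircase-bound {h} (x≤h ∷ p) (suc i) =
  ≤-trans (staircase-bound p i) (≤-trans (s≤s (+-monoˡ-≤ i x≤h)) (≤-reflexive (sym (+-suc h i))))

∈-profiles⁺ : ∀ (u : ℕ → List ℕ) m k → (∀ t → t < k → IsStaircase 1 (suc (t + m)) (u t)) →
  applyUpTo u k ∈ profiles m k
∈-profiles⁺ u m zero    rows = here refl
∈-profiles⁺ u m (suc k) rows = ∈-cartesianProductWith⁺ _∷_
  (∈-staircases⁺ (rows 0 (s≤s z≤n)))
  (∈-profiles⁺ (u ∘ suc) (suc m) k λ t t<k →
    subst (λ l → IsStaircase 1 (suc l) (u (suc t))) (sym (+-suc t m)) (rows (suc t) (s≤s t<k)))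

∈-profiles⁻ : ∀ m k {P} → P ∈ profiles m k →
  P ≡ applyUpTo (at [] P) k × (∀ t → t < k → IsStaircase 1 (suc (t + m)) (at [] P t))
∈-profiles⁻ m zero    (here refl) = refl , λ _ ()
∈-profiles⁻ m (suc k) p
  with _ , Q , q , Q∈ , refl ← ∈-cartesianProductWith⁻ _∷_ (staircases 1 (suc m)) (profiles (suc m) k) p
  with eq , rows ← ∈-profiles⁻ (suc m) k Q∈ = cong (_ ∷_) eq , λ where
    zero    _         → ∈-staircases⁻ 1 (suc m) q
    (suc t) (s≤s t<k) → subst (λ l → IsStaircase 1 (suc l) (at [] Q t)) (+-suc t m) (rows t t<k)

profiles-unique : ∀ m k → Unique (profiles m k)
profiles-unique m zero    = [] ∷ []
profiles-unique m (suc k) =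
  Unique.cartesianProductWith⁺ _∷_ ∷-injective (staircases-unique 1 (suc m)) (profiles-unique (suc m) k)

-- Reads a column height off a membership test, as the length of the initial run of `true`. The run
-- is everything exactly when the test is downward closed, which is the hypothesis of
-- `cut-complete`.
cut : (ℕ → Bool) → ℕ → ℕ
cut f zero    = 0
cut f (suc n) = if f 0 then suc (cut (f ∘ suc) n) else 0

cut-≤ : ∀ f n → cut f n ≤ n
cut-≤ f zero    = z≤n
cut-≤ f (suc n) with f 0
... | true  = s≤s (cut-≤ (f ∘ suc) n)
... | false = z≤n

cut-sound : ∀ f n {h} → h < cut f n → f h ≡ true
cut-sound f (suc n) {h} h<c with f 0 in eq
cut-sound f (suc n) {zero}  h<c       | true = eq
cut-sound f (suc n) {suc h} (s≤s h<c) | true = cut-sound (f ∘ suc) n h<c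

cut-complete : ∀ f n → (∀ h → suc h < n → f (suc h) ≡ true → f h ≡ true) →
  ∀ {h} → h < n → f h ≡ true → h < cut f n
cut-complete f (suc n) down {h} h<n fh with f 0 in eq
cut-complete f (suc n) down {zero}  h<n       fh | true = s≤s z≤n
cut-complete f (suc n) down {suc h} (s≤s h<n) fh | true =
  s≤s (cut-complete (f ∘ suc) n (λ i i<n → down (suc i) (s≤s i<n)) h<n fh)
cut-complete f (suc n) down {h} h<n fh | false = contradiction (trans (sym eq) (f-zero h h<n fh)) λ ()
  where
  f-zero : ∀ h → h < suc n → f h ≡ true → f 0 ≡ true
  f-zero zero    _   fh = fh
  f-zero (suc h) h<n fh = f-zero h (m<n⇒m<1+n (s≤s⁻¹ h<n)) (down h h<n fh)

cut-threshold : ∀ f {n c} → c ≤ n → (∀ h → h < n → f h ≡ (h <ᵇ c)) → cut f n ≡ c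
cut-threshold f {zero}  {zero}  c≤n       eq = refl
cut-threshold f {suc n} {zero}  c≤n       eq rewrite eq 0 (s≤s z≤n) = refl
cut-threshold f {suc n} {suc c} (s≤s c≤n) eq rewrite eq 0 (s≤s z≤n) =
  cong suc (cut-threshold (f ∘ suc) c≤n (λ h h<n → eq (suc h) (s≤s h<n)))

unique-concatMap : ∀ {A B : Set} {f : A → List B} {xs} → Unique xs → (∀ x → Unique (f x)) →
  (∀ {x x′ z} → z ∈ f x → z ∈ f x′ → x ≡ x′) → Unique (concatMap f xs)
unique-concatMap                     []       u d = []
unique-concatMap {f = f} {x ∷ xs} (x∉ ∷ p) u d = Unique.++⁺ (u x) (unique-concatMap p u d) disjoint
  where
  disjoint : ∀ {z} → ¬ (z ∈ f x × z ∈ concatMap f xs)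
  disjoint (z∈fx , z∈rest) with _ , z∈ , y∈ ← ∈-concat⁻′ (map f xs) z∈rest
    with _ , x′∈ , refl ← ∈-map⁻ f y∈ = All.lookup x∉ x′∈ (d z∈fx z∈)

∈-concatMap-intro : ∀ {A B : Set} (f : A → List B) {xs x z} → x ∈ xs → z ∈ f x → z ∈ concatMap f xs
∈-concatMap-intro f x∈ z∈ = ∈-concat⁺′ z∈ (∈-map⁺ f x∈)

∈-concatMap-elim : ∀ {A B : Set} (f : A → List B) xs {z} → z ∈ concatMap f xs → ∃ λ x → x ∈ xs × z ∈ f x
∈-concatMap-elim f xs z∈ with _ , z∈y , y∈ ← ∈-concat⁻′ (map f xs) z∈
  with x , x∈ , refl ← ∈-map⁻ f y∈ = x , x∈ , z∈y

unique-↭ : ∀ {A : Set} {xs ys : List A} → Unique xs → Unique ys →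
  (∀ {z} → z ∈ xs → z ∈ ys) → (∀ {z} → z ∈ ys → z ∈ xs) → xs ↭ ys
unique-↭ ux uy to from = ∼bag⇒↭ (unique∧set⇒bag ux uy (mk⇔ to from))

-- The point (m , i , h) is the h-th lowest element of the i-th chain in the m-th layer.
chain : ℕ → ℕ → List ℕ³
chain m i = map (λ h → m , i , h) (upTo (suc i))

layer : ℕ → List ℕ³
layer m = concatMap (chain m) (upTo (suc m))

points : ℕ → List ℕ³
points N = concatMap layer (upTo (suc N))

IsPoint : ℕ → ℕ³ → Set
IsPoint N (m , i , h) = h ≤ i × i ≤ m × m ≤ N

∈-points⁺ : ∀ {N} p → IsPoint N p → p ∈ points N
∈-points⁺ (m , i , h) (h≤i , i≤m , m≤N) = ∈-concatMap-intro layer (∈-upTo⁺ (s≤s m≤N))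
  (∈-concatMap-intro (chain m) (∈-upTo⁺ (s≤s i≤m)) (∈-map⁺ (λ h → m , i , h) (∈-upTo⁺ (s≤s h≤i))))

∈-points⁻ : ∀ {N} p → p ∈ points N → IsPoint N p
∈-points⁻ {N} p p∈ with m , m∈ , p∈ ← ∈-concatMap-elim layer (upTo (suc N)) p∈
  with i , i∈ , p∈ ← ∈-concatMap-elim (chain m) (upTo (suc m)) p∈
  with h , h∈ , refl ← ∈-map⁻ (λ h → m , i , h) p∈ =
  s≤s⁻¹ (∈-upTo⁻ h∈) , s≤s⁻¹ (∈-upTo⁻ i∈) , s≤s⁻¹ (∈-upTo⁻ m∈)

points-unique : ∀ N → Unique (points N)
points-unique N = unique-concatMap (Unique.upTo⁺ (suc N))
  (λ m → unique-concatMap (Unique.upTo⁺ (suc m))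
    (λ i → Unique.map⁺ (cong (proj₂ ∘ proj₂)) (Unique.upTo⁺ (suc i)))
    (λ {i} {i′} z∈ z∈′ → trans (sym (chain-index m i z∈)) (chain-index m i′ z∈′)))
  (λ {m} {m′} z∈ z∈′ → trans (sym (layer-index m z∈)) (layer-index m′ z∈′))
  where
  chain-index : ∀ m i {z} → z ∈ chain m i → proj₁ (proj₂ z) ≡ i
  chain-index m i z∈ with _ , _ , refl ← ∈-map⁻ (λ h → m , i , h) z∈ = refl
  layer-index : ∀ m {z} → z ∈ layer m → proj₁ z ≡ m
  layer-index m z∈ with i , _ , z∈ ← ∈-concatMap-elim (chain m) (upTo (suc m)) z∈
    with _ , _ , refl ← ∈-map⁻ (λ h → m , i , h) z∈ = refl

module _ {A : Set} {P : A → Set} (P? : ∀ x → Dec (P x)) where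

  length-filter-concatMap : ∀ {B : Set} (f : B → List A) xs →
    length (filter P? (concatMap f xs)) ≡ sum (map (λ x → length (filter P? (f x))) xs)
  length-filter-concatMap f []       = refl
  length-filter-concatMap f (x ∷ xs) = trans
    (cong length (filter-++ P? (f x) (concatMap f xs)))
    (trans (length-++ (filter P? (f x))) (cong (_ +_) (length-filter-concatMap f xs)))

  length-filter-threshold : ∀ (f : ℕ → A) {n c} → c ≤ n → (∀ h → does (P? (f h)) ≡ (h <ᵇ c)) →
    length (filter P? (applyUpTo f n)) ≡ c
  length-filter-threshold f {zero}  {zero}  c≤n       eq = refl
  length-filter-threshold f {suc n} {zero}  c≤n       eq rewrite eq 0 =
    length-filter-threshold (f ∘ suc) {n} z≤n (eq ∘ suc)
  length-filter-threshold f {suc n} {suc c} (s≤s c≤n) eq rewrite eq 0 =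
    cong suc (length-filter-threshold (f ∘ suc) c≤n (eq ∘ suc))

  ∣tabulate∣ : ∀ {n} (f : Fin n → A) →
    ∣ Vec.tabulate (λ j → does (P? (f j))) ∣ ≡ length (filter P? (tabulate f))
  ∣tabulate∣ {zero}  f = refl
  ∣tabulate∣ {suc n} f with does (P? (f zero))
  ... | true  = cong suc (∣tabulate∣ (f ∘ suc))
  ... | false = ∣tabulate∣ (f ∘ suc)

-- Counting lower sets by their column heights

unique-map : ∀ {A B : Set} (f : A → B) (f⁻ : B → A) {xs} → (∀ {x} → x ∈ xs → f⁻ (f x) ≡ x) →
  Unique xs → Unique (map f xs)
unique-map f f⁻ inv []       = []
unique-map f f⁻ {x ∷ xs} inv (x∉ ∷ p) = All.tabulate fresh ∷ unique-map f f⁻ (inv ∘ there) p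
  where
  fresh : ∀ {z} → z ∈ map f xs → f x ≢ z
  fresh z∈ fx≡z with x′ , x′∈ , refl ← ∈-map⁻ f z∈ = All.lookup x∉ x′∈
    (trans (sym (inv (here refl))) (trans (cong f⁻ fx≡z) (inv (there x′∈))))

-- Turns a bijection between a duplicate-free list of codes and the subsets satisfying P into
-- cardinalities, plain or refined by size. The inverse laws are asked only on codes and on such
-- subsets: an arbitrary list of lists is not recovered from its subset.
module Coding {A : Set} {M : ℕ} {P : Subset M → Set} (decode : A → Subset M) (encode : Subset M → A)
  (codes : List A) (codes-unique : Unique codes)
  (decode-P : ∀ {a} → a ∈ codes → P (decode a))
  (encode-decode : ∀ {a} → a ∈ codes → encode (decode a) ≡ a)
  (encode-∈ : ∀ I → P I → encode I ∈ codes)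
  (decode-encode : ∀ I → P I → decode (encode I) ≡ I) where

  private
    L = map decode codes
    L-unique : Unique L
    L-unique = unique-map decode encode encode-decode codes-unique
    L-sound : ∀ I → I ∈ L → P I
    L-sound I I∈ with _ , a∈ , refl ← ∈-map⁻ decode I∈ = decode-P a∈
    L-complete : ∀ I → P I → I ∈ L
    L-complete I pI = subst (_∈ L) (decode-encode I pI) (∈-map⁺ decode (encode-∈ I pI))

  hasCard : HasCard P (length codes)
  hasCard = L , L-unique , length-map decode codes , λ I → L-sound I , L-complete I

  hasCard-size : (w : A → ℕ) → (∀ {a} → a ∈ codes → ∣ decode a ∣ ≡ w a) → ∀ k →
    HasCard (λ I → P I × ∣ I ∣ ≡ k) (count k (map w codes))
  hasCard-size w size k = filter hasSize? L , Unique.filter⁺ hasSize? L-unique , len codes size ,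
    λ I → (λ I∈ → let I∈L , eq = ∈-filter⁻ hasSize? I∈ in L-sound I I∈L , eq) ,
          (λ (pI , eq) → ∈-filter⁺ hasSize? (L-complete I pI) eq)
    where
    hasSize? : ∀ (I : Subset M) → Dec (∣ I ∣ ≡ k)
    hasSize? I = ∣ I ∣ ≟ k
    len : ∀ codes → (∀ {a} → a ∈ codes → ∣ decode a ∣ ≡ w a) →
      length (filter hasSize? (map decode codes)) ≡ count k (map w codes)
    len []          size = refl
    len (a ∷ codes) size rewrite size (here refl) with does (w a ≟ k)
    ... | true  = cong suc (len codes (size ∘ there))
    ... | false = len codes (size ∘ there)

true⇒ : ∀ {A : Set} (a? : Dec A) → does a? ≡ true → A
true⇒ (yes a) _ = a

data _⋖_ : ℕ³ → ℕ³ → Set where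
  along  : ∀ {m i h} → (m , i , h) ⋖ (m , i , suc h)
  across : ∀ {m i h} → (m , i , h) ⋖ (m , suc i , suc h)

module Ideals {N M : ℕ} (κ : Fin M → ℕ³)
  (κ-injective : ∀ {j j′} → κ j ≡ κ j′ → j ≡ j′)
  (κ-point : ∀ j → IsPoint N (κ j))
  (κ-surjective : ∀ p → IsPoint N p → ∃ λ j → κ j ≡ p) where

  -- Closure under covering pairs only; the step to the reflexive-transitive closure is made once,
  -- for all colours, by `closed-Star` and `closed-Star-flip`.
  IsLowerSet : Subset M → Set
  IsLowerSet I = ∀ j j′ → κ j ⋖ κ j′ → j′ Sub.∈ I → j Sub.∈ I

  codes : List (List (List ℕ))
  codes = profiles 0 (suc N)

  height : List (List ℕ) → ℕ → ℕ → ℕ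
  height P m i = at 0 (at [] P m) i

  below? : ∀ P (p : ℕ³) → Dec (proj₂ (proj₂ p) < height P (proj₁ p) (proj₁ (proj₂ p)))
  below? P (m , i , h) = h <? height P m i

  decode : List (List ℕ) → Subset M
  decode P = Vec.tabulate (λ j → does (below? P (κ j)))

  ∈-tabulate : ∀ {f : Fin M → Bool} {j} → j Sub.∈ Vec.tabulate f → f j ≡ true
  ∈-tabulate {f} {j} j∈ = trans (sym (Vec.lookup∘tabulate f j)) (Vec.[]=⇒lookup j∈)

  tabulate-∈ : ∀ {f : Fin M → Bool} {j} → f j ≡ true → j Sub.∈ Vec.tabulate f
  tabulate-∈ {f} {j} eq = Vec.lookup⇒[]= j (Vec.tabulate f) (trans (Vec.lookup∘tabulate f j) eq)

  -- Membership phrased in coordinates. A search through all indices makes it total on triples, so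
  -- encoding can probe (m , i , h) without first naming an index for it.
  marked? : ∀ I (p : ℕ³) → Dec (∃ λ j → κ j ≡ p × j Sub.∈ I)
  marked? I p = any? λ j → ≡-dec _≟_ (≡-dec _≟_ _≟_) (κ j) p ×-dec (j ∈? I)

  marked : Subset M → ℕ → ℕ → ℕ → Bool
  marked I m i h = does (marked? I (m , i , h))

  marked⁺ : ∀ {I p j} → κ j ≡ p → j Sub.∈ I → does (marked? I p) ≡ true
  marked⁺ {I} {p} {j} eq j∈ = dec-true (marked? I p) (j , eq , j∈)

  marked⁻ : ∀ {I p j} → κ j ≡ p → does (marked? I p) ≡ true → j Sub.∈ I
  marked⁻ {I} {p} eq t with j′ , eq′ , j′∈ ← true⇒ (marked? I p) t =
    subst (Sub._∈ I) (κ-injective (trans eq′ (sym eq))) j′∈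

  encodeHeight : Subset M → ℕ → ℕ → ℕ
  encodeHeight I m i = cut (marked I m i) (suc i)

  encodeRow : Subset M → ℕ → List ℕ
  encodeRow I m = applyUpTo (encodeHeight I m) (suc m)

  encode : Subset M → List (List ℕ)
  encode I = applyUpTo (encodeRow I) (suc N)

  row : ∀ {P} → P ∈ codes → ∀ {m} → m ≤ N → IsStaircase 1 (suc m) (at [] P m)
  row {P} P∈ {m} m≤N = subst (λ l → IsStaircase 1 (suc l) (at [] P m)) (+-identityʳ m)
    (proj₂ (∈-profiles⁻ 0 (suc N) P∈) m (s≤s m≤N))

  below⇒∈ : ∀ {P j m i h} → κ j ≡ (m , i , h) → h < height P m i → j Sub.∈ decode P
  below⇒∈ {P} {j} eq h< = tabulate-∈ (trans (cong (λ p → does (below? P p)) eq) (dec-true (below? P _) h<))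

  ∈⇒below : ∀ {P j m i h} → κ j ≡ (m , i , h) → j Sub.∈ decode P → h < height P m i
  ∈⇒below {P} eq j∈ = true⇒ (below? P _)
    (trans (sym (cong (λ p → does (below? P p)) eq)) (∈-tabulate j∈))

  decode-lower : ∀ {P} → P ∈ codes → IsLowerSet (decode P)
  -- `go` replaces `κ j` and `κ j′` by variables so that the covering relation can be matched on.
  -- Along a column a height threshold is closed by itself; across columns the staircase step is
  -- what is needed.
  decode-lower {P} P∈ j j′ c j′∈ = go refl refl c
    where
    go : ∀ {p p′} → κ j ≡ p → κ j′ ≡ p′ → p ⋖ p′ → j Sub.∈ decode P
    go eq eq′ along  = below⇒∈ {P} eq (<-trans (n<1+n _) (∈⇒below {P} eq′ j′∈))
    go {m , i , h} eq eq′ across = below⇒∈ {P} eq (s≤s⁻¹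
      (≤-trans (∈⇒below {P} eq′ j′∈) (staircase-step (row P∈ m≤N) i)))
      where m≤N = proj₂ (proj₂ (subst (IsPoint N) eq (κ-point j)))

  encode-decode : ∀ {P} → P ∈ codes → encode (decode P) ≡ P
  encode-decode {P} P∈ = trans (applyUpTo-cong (suc N) λ m m≤N →
      trans (applyUpTo-cong (suc m) λ i i≤m → heights (s≤s⁻¹ m≤N) (s≤s⁻¹ i≤m))
            (sym (staircase-applyUpTo⁻ (row P∈ (s≤s⁻¹ m≤N)))))
    (sym (proj₁ (∈-profiles⁻ 0 (suc N) P∈)))
    where
    heights : ∀ {m i} → m ≤ N → i ≤ m → encodeHeight (decode P) m i ≡ height P m i
    -- The run is measured only over the i + 1 places of the column, and nothing is truncated
    -- because the height is at most 1 + i.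
    heights {m} {i} m≤N i≤m = cut-threshold _ (staircase-bound (row P∈ m≤N) i) λ h h<i →
      let j , eq = κ-surjective (m , i , h) (s≤s⁻¹ h<i , i≤m , m≤N) in agree h j eq
      where
      agree : ∀ h j → κ j ≡ (m , i , h) → marked (decode P) m i h ≡ does (below? P (m , i , h))
      agree h j eq = does-⇔ (mk⇔
        (λ (j′ , eq′ , j′∈) → ∈⇒below {P} eq′ j′∈) (λ h< → j , eq , below⇒∈ {P} eq h<))
        (marked? (decode P) (m , i , h)) (below? P (m , i , h))

  module _ {I : Subset M} (lower : IsLowerSet I) where

    marked-lower : ∀ {m i h m′ i′ h′} → IsPoint N (m , i , h) → IsPoint N (m′ , i′ , h′) →
      (m , i , h) ⋖ (m′ , i′ , h′) → marked I m′ i′ h′ ≡ true → marked I m i h ≡ true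
    marked-lower p p′ c t with j , eq ← κ-surjective _ p | j′ , eq′ ← κ-surjective _ p′ =
      marked⁺ eq (lower j j′ (subst₂ _⋖_ (sym eq) (sym eq′) c) (marked⁻ eq′ t))

    cut-along : ∀ {m i h} → i ≤ m → m ≤ N → suc h < suc i →
      marked I m i (suc h) ≡ true → marked I m i h ≡ true
    cut-along i≤m m≤N h<i = marked-lower
      (≤-trans (n≤1+n _) (s≤s⁻¹ h<i) , i≤m , m≤N) (s≤s⁻¹ h<i , i≤m , m≤N) along

    cut-across : ∀ {m i} → suc i ≤ m → m ≤ N →
      encodeHeight I m (suc i) ≤ suc (encodeHeight I m i)
    cut-across {m} {i} i<m m≤N with encodeHeight I m (suc i) in eq
    ... | zero        = z≤n
    ... | suc zero    = s≤s z≤n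
    -- Heights 0 and 1 satisfy the inequality trivially. At height h + 2 the element h + 1 of column
    -- i + 1 is present, and it covers element h of column i, which forces that column to have
    -- height at least h + 1.
    ... | suc (suc h) = s≤s (cut-complete (marked I m i) (suc i)
      (λ h → cut-along (<⇒≤ i<m) m≤N) h<i
      (marked-lower (s≤s⁻¹ h<i , <⇒≤ i<m , m≤N) (h<i , i<m , m≤N) across
        (cut-sound (marked I m (suc i)) (suc (suc i)) (≤-reflexive (sym eq)))))
      where
      h<i : h < suc i
      h<i = s≤s⁻¹ (≤-trans (≤-reflexive (sym eq)) (cut-≤ (marked I m (suc i)) (suc (suc i))))

    encode-∈ : encode I ∈ codes
    encode-∈ = ∈-profiles⁺ (encodeRow I) 0 (suc N) λ m m≤N →
      subst (λ l → IsStaircase 1 (suc l) (encodeRow I m)) (sym (+-identityʳ m))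
        (staircase-applyUpTo⁺ (encodeHeight I m) (suc m)
        (λ _ → cut-≤ (marked I m 0) 1)
        (λ i i<m → cut-across (s≤s⁻¹ i<m) (s≤s⁻¹ m≤N)))

    height-encode : ∀ {m i} → m ≤ N → i ≤ m → height (encode I) m i ≡ encodeHeight I m i
    height-encode {m} {i} m≤N i≤m = trans (cong (λ l → at 0 l i) (at-applyUpTo [] (encodeRow I) (s≤s m≤N)))
      (at-applyUpTo 0 (encodeHeight I m) (s≤s i≤m))

    ∈-decode-encode : ∀ {j m i h} → κ j ≡ (m , i , h) → j Sub.∈ decode (encode I) ⇔ j Sub.∈ I
    ∈-decode-encode {j} {m} {i} {h} eq with h≤i , i≤m , m≤N ← subst (IsPoint N) eq (κ-point j) = mk⇔
      (λ j∈ → marked⁻ eq (cut-sound (marked I m i) (suc i)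
        (≤-trans (∈⇒below {encode I} eq j∈) (≤-reflexive (height-encode m≤N i≤m)))))
      (λ j∈ → below⇒∈ {encode I} eq (≤-trans
        (cut-complete (marked I m i) (suc i) (λ _ → cut-along i≤m m≤N) (s≤s h≤i) (marked⁺ eq j∈))
        (≤-reflexive (sym (height-encode m≤N i≤m)))))

    decode-encode : decode (encode I) ≡ I
    decode-encode = ⊆-antisym (Equivalence.to (∈-decode-encode refl)) (Equivalence.from (∈-decode-encode refl))

  κ-points : tabulate κ ↭ points N
  κ-points = unique-↭ (Unique.tabulate⁺ κ-injective) (points-unique N) to from
    where
    to : ∀ {p} → p ∈ tabulate κ → p ∈ points N
    to p∈ with j , refl ← ∈-tabulate⁻ p∈ = ∈-points⁺ (κ j) (κ-point j)
    from : ∀ {p} → p ∈ points N → p ∈ tabulate κ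
    from {p} p∈ = let j , eq = κ-surjective p (∈-points⁻ p p∈) in subst (_∈ tabulate κ) eq (∈-tabulate⁺ j)

  ∣decode∣ : ∀ {P} → P ∈ codes → ∣ decode P ∣ ≡ area P
  ∣decode∣ {P} P∈ = begin
    ∣ decode P ∣
      ≡⟨ ∣tabulate∣ (below? P) κ ⟩
    length (filter (below? P) (tabulate κ))
      -- The count does not depend on the order of the elements, so they may be listed layer by
      -- layer and chain by chain, where each chain contributes its height.
      ≡⟨ ↭-length (filter-↭ (below? P) κ-points) ⟩
    length (filter (below? P) (points N))
      ≡⟨ length-filter-concatMap (below? P) layer (upTo (suc N)) ⟩
    sum (map (λ m → length (filter (below? P) (layer m))) (upTo (suc N)))
      ≡⟨ cong sum (map-upTo _ (suc N)) ⟩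
    sum (applyUpTo (λ m → length (filter (below? P) (layer m))) (suc N))
      ≡⟨ cong sum (applyUpTo-cong (suc N) λ m m≤N → layer-size (s≤s⁻¹ m≤N)) ⟩
    sum (applyUpTo (sum ∘ at [] P) (suc N))
      ≡⟨ cong sum (map-applyUpTo (at [] P) sum (suc N)) ⟨
    sum (map sum (applyUpTo (at [] P) (suc N)))
      ≡⟨ cong area (proj₁ (∈-profiles⁻ 0 (suc N) P∈)) ⟨
    area P ∎
    where
    open ≡-Reasoning
    layer-size : ∀ {m} → m ≤ N → length (filter (below? P) (layer m)) ≡ sum (at [] P m)
    layer-size {m} m≤N = begin
      length (filter (below? P) (layer m))
        ≡⟨ length-filter-concatMap (below? P) (chain m) (upTo (suc m)) ⟩
      sum (map (λ i → length (filter (below? P) (chain m i))) (upTo (suc m)))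
        ≡⟨ cong sum (map-cong (λ i → trans
             (cong (length ∘ filter (below? P)) (map-upTo _ (suc i)))
             (length-filter-threshold (below? P) _ (staircase-bound (row P∈ m≤N) i) (λ h → refl)))
             (upTo (suc m))) ⟩
      sum (map (height P m) (upTo (suc m)))
        ≡⟨ cong sum (map-upTo _ (suc m)) ⟩
      sum (applyUpTo (height P m) (suc m))
        ≡⟨ cong sum (staircase-applyUpTo⁻ (row P∈ m≤N)) ⟨
      sum (at [] P m) ∎

  open Coding {P = IsLowerSet} decode encode codes (profiles-unique 0 (suc N))
    decode-lower encode-decode (λ _ → encode-∈) (λ _ → decode-encode)

  lowerSets-card : HasCard IsLowerSet (prodCatalan (2 + N))
  lowerSets-card = subst (HasCard IsLowerSet) (begin
    length codes                           ≡⟨ length-map area codes ⟨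
    length (map area codes)                ≡⟨ ↭-length (profiles-prodQCat N) ⟩
    length (exponents (prodQCat (2 + N)))  ≡⟨ length-exponents-prod (range 1 (2 + N)) ⟩
    prodCatalan (2 + N)                    ∎) hasCard
    where open ≡-Reasoning

  lowerSets-card-size : ∀ k → HasCard (λ I → IsLowerSet I × ∣ I ∣ ≡ k) (coeff k (prodQCat (2 + N)))
  lowerSets-card-size k = subst (HasCard _) (begin
    count k (map area codes)                 ≡⟨ ↭-length (filter-↭ (_≟ k) (profiles-prodQCat N)) ⟩
    count k (exponents (prodQCat (2 + N)))   ≡⟨ coeff-count k (prodQCat (2 + N)) ⟨
    coeff k (prodQCat (2 + N))               ∎) (hasCard-size area ∣decode∣ k)
    where open ≡-Reasoning

-- The posets of coloured moves

open Equivalence using (to; from)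

HasCard-cong : ∀ {M k} {P Q : Subset M → Set} → (∀ I → P I ⇔ Q I) → HasCard P k → HasCard Q k
HasCard-cong P⇔Q (L , unique , len , mem) = L , unique , len ,
  λ I → to (P⇔Q I) ∘ proj₁ (mem I) , proj₂ (mem I) ∘ from (P⇔Q I)

∁-involutive : ∀ {M} (I : Subset M) → ∁ (∁ I) ≡ I
∁-involutive I = ⊆-antisym (λ i∈ → x∉∁p⇒x∈p (x∈∁p⇒x∉p i∈)) (λ i∈ → x∉p⇒x∈∁p (x∈p⇒x∉∁p i∈))

HasCard-∁ : ∀ {M k} {P : Subset M → Set} → HasCard P k → HasCard (P ∘ ∁) k
HasCard-∁ {P = P} (L , unique , len , mem) = subst (HasCard _) len
  (Coding.hasCard {P = P ∘ ∁} ∁ ∁ L unique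
    (λ {I} I∈ → subst P (sym (∁-involutive I)) (proj₁ (mem I) I∈))
    (λ {I} _ → ∁-involutive I) (λ I → proj₂ (mem (∁ I))) (λ I _ → ∁-involutive I))

Closed : ∀ {M} → (Fin M → Fin M → Set) → Subset M → Set
Closed R I = ∀ i j → R i j → j Sub.∈ I → i Sub.∈ I

closed-Star : ∀ {M R} {I : Subset M} → Closed R I → Closed (Star R) I
closed-Star c i j ε        j∈ = j∈
closed-Star c i j (x ◅ xs) j∈ = c i _ x (closed-Star c _ j xs j∈)

closed-Star-flip : ∀ {M R} {I : Subset M} → Closed (λ i j → R j i) I → Closed (λ i j → Star R j i) I
closed-Star-flip c i j ε        j∈ = j∈
closed-Star-flip c i j (x ◅ xs) j∈ = closed-Star-flip c i _ xs (c _ j x j∈)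

-- Complements of down-sets are up-sets, that is, down-sets of the dual.
closed-∁ : ∀ {M R} {I : Subset M} → Closed (λ i j → R j i) (∁ I) ⇔ Closed R I
closed-∁ = mk⇔
  (λ c i j x j∈ → x∉∁p⇒x∈p λ i∈ → x∈p⇒x∉∁p j∈ (c j i x i∈))
  (λ c i j x j∈ → x∉p⇒x∈∁p λ i∈ → x∈∁p⇒x∉p j∈ (c j i x i∈))

δ : Fin 4 → Fin 4 → ℕ
δ a k = if does (a Fin.≟ k) then 1 else 0

-- q′ arises from q by moving one unit from the entry a to the entry c.
record Move (a c : Fin 4) (q q′ : Fin 4 → ℕ) : Set where
  constructor mkMove
  field balance : ∀ k → q′ k + δ a k ≡ q k + δ c k

open Move

δ-permute : ∀ (π : Permutation′ 4) a k → δ (π ⟨$⟩ʳ a) (π ⟨$⟩ʳ k) ≡ δ a k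
δ-permute π a k = cong (if_then 1 else 0) (does-⇔ (mk⇔ injective (cong (π ⟨$⟩ʳ_))) (_ Fin.≟ _) (a Fin.≟ k))
  where
  injective : π ⟨$⟩ʳ a ≡ π ⟨$⟩ʳ k → a ≡ k
  injective eq = trans (sym (inverseˡ π)) (trans (cong (π ⟨$⟩ˡ_) eq) (inverseˡ π))

Move-permute : ∀ (π : Permutation′ 4) {a c q q′} →
  Move (π ⟨$⟩ʳ a) (π ⟨$⟩ʳ c) q q′ ⇔ Move a c (q ∘ (π ⟨$⟩ʳ_)) (q′ ∘ (π ⟨$⟩ʳ_))
Move-permute π {a} {c} {q} {q′} = mk⇔
  (λ move → mkMove λ k → subst₂ (λ d e → q′ (π ⟨$⟩ʳ k) + d ≡ q (π ⟨$⟩ʳ k) + e)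
    (δ-permute π a k) (δ-permute π c k) (balance move (π ⟨$⟩ʳ k)))
  (λ move → mkMove λ k → subst (λ k → q′ k + δ (π ⟨$⟩ʳ a) k ≡ q k + δ (π ⟨$⟩ʳ c) k) (inverseʳ π)
    (subst₂ (λ d e → q′ (π ⟨$⟩ʳ (π ⟨$⟩ˡ k)) + d ≡ q (π ⟨$⟩ʳ (π ⟨$⟩ˡ k)) + e)
      (sym (δ-permute π a _)) (sym (δ-permute π c _)) (balance move (π ⟨$⟩ˡ k))))

Move-flip : ∀ {a c q q′} → Move a c q q′ → Move c a q′ q
Move-flip move = mkMove (sym ∘ balance move)

Move-≡ : ∀ {a a′ c c′ q q′} → a ≡ a′ → c ≡ c′ → Move a c q q′ → Move a′ c′ q q′
Move-≡ refl refl move = move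

sum-δ : ∀ a → total (δ a) ≡ 1
sum-δ 0F = refl
sum-δ 1F = refl
sum-δ 2F = refl
sum-δ 3F = refl

sum-+-δ : ∀ q a → total (λ k → q k + δ a k) ≡ suc (total q)
sum-+-δ q a = begin
  total (λ k → q k + δ a k) ≡⟨ interleave (q 0F) (q 1F) (q 2F) (q 3F) (δ a 0F) (δ a 1F) (δ a 2F) (δ a 3F) ⟩
  total (δ a) + total q       ≡⟨ cong (_+ total q) (sum-δ a) ⟩
  suc (total q)             ∎
  where
  open ≡-Reasoning
  interleave : ∀ q₀ q₁ q₂ q₃ d₀ d₁ d₂ d₃ → (q₀ + d₀) + ((q₁ + d₁) + ((q₂ + d₂) + ((q₃ + d₃) + 0)))
    ≡ (d₀ + (d₁ + (d₂ + (d₃ + 0)))) + (q₀ + (q₁ + (q₂ + (q₃ + 0))))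
  interleave = solve 8 (λ q₀ q₁ q₂ q₃ d₀ d₁ d₂ d₃ →
    (q₀ :+ d₀) :+ ((q₁ :+ d₁) :+ ((q₂ :+ d₂) :+ ((q₃ :+ d₃) :+ con 0)))
    := (d₀ :+ (d₁ :+ (d₂ :+ (d₃ :+ con 0)))) :+ (q₀ :+ (q₁ :+ (q₂ :+ (q₃ :+ con 0))))) refl
    where open +-*-Solver

-- The slack is a truncated difference and awkward to compute with. A fixed total determines it from
-- the other three entries, so every identity about it is deduced from them.
head-from-sum : ∀ (u v : Fin 4 → ℕ) → total u ≡ total v → (∀ k → u (suc k) ≡ v (suc k)) → ∀ k → u k ≡ v k
head-from-sum u v eq tail zero    = +-cancelʳ-≡ _ (u 0F) (v 0F)
  (trans (cong (u 0F +_) (sym (sum-cong-≗ {3} tail))) eq)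
head-from-sum u v eq tail (suc k) = tail k

Move-from-tail : ∀ {a c q q′} → total q ≡ total q′ → (∀ k → q′ (suc k) + δ a (suc k) ≡ q (suc k) + δ c (suc k)) →
  Move a c q q′
Move-from-tail {a} {c} {q} {q′} eq tail = mkMove (head-from-sum (λ k → q′ k + δ a k) (λ k → q k + δ c k)
  (trans (sum-+-δ q′ a) (trans (cong suc (sym eq)) (sym (sum-+-δ q c)))) tail)

source target : Color → Fin 4
source r = 0F
source g = 0F
source y = 0F
source b = 1F
source o = 1F
source s = 3F
target r = 1F
target g = 2F
target y = 3F
target b = 2F
target o = 3F
target s = 2F

-- The barycentric coordinates, the entry 0 being the slack N − c₁ − c₂ − c₃.
bary : ℕ → ℕ³ → Fin 4 → ℕ
bary N (c₁ , c₂ , c₃) 0F = N ∸ (c₁ + c₂ + c₃)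
bary N (c₁ , c₂ , c₃) 1F = c₁
bary N (c₁ , c₂ , c₃) 2F = c₂
bary N (c₁ , c₂ , c₃) 3F = c₃

InT : ℕ → ℕ³ → Set
InT N (c₁ , c₂ , c₃) = c₁ + c₂ + c₃ ≤ N

inT? : ∀ N p → Dec (InT N p)
inT? N (c₁ , c₂ , c₃) = c₁ + c₂ + c₃ ≤? N

+-assoc₃ : ∀ a c d → a + (c + (d + 0)) ≡ a + c + d
+-assoc₃ = solve 3 (λ a c d → a :+ (c :+ (d :+ con 0)) := a :+ c :+ d) refl
  where open +-*-Solver

sum-bary : ∀ {N} p → InT N p → total (bary N p) ≡ N
sum-bary {N} (c₁ , c₂ , c₃) p∈ = trans (cong (_+_ (N ∸ (c₁ + c₂ + c₃))) (+-assoc₃ c₁ c₂ c₃)) (m∸n+n≡m p∈)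

-- Moves the possibly negative displacement to the other side, so that the integer equation of a
-- cover becomes an equation of natural numbers, the form used by `Move`.
⊖-component : ∀ {a a′} n m → ℤ.+ a′ ≡ ℤ.+ a ℤ.+ (m ℤ.⊖ n) ⇔ a′ + n ≡ a + m
⊖-component {a} {a′} n m = mk⇔
  (λ eq → ℤ.+-injective (begin
    ℤ.+ (a′ + n)                     ≡⟨ cong (ℤ._+ ℤ.+ n) eq ⟩
    ℤ.+ a ℤ.+ (m ℤ.⊖ n) ℤ.+ ℤ.+ n    ≡⟨ undo ⟩
    ℤ.+ (a + m)                      ∎))
  (λ eq → ∙-cancelʳ (ℤ.+ n) _ _ (trans (cong ℤ.+_ eq) (sym undo)))
  where
  open ≡-Reasoning
  undo : ℤ.+ a ℤ.+ (m ℤ.⊖ n) ℤ.+ ℤ.+ n ≡ ℤ.+ (a + m)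
  undo = begin
    ℤ.+ a ℤ.+ (m ℤ.⊖ n) ℤ.+ ℤ.+ n     ≡⟨ ℤ.+-assoc (ℤ.+ a) (m ℤ.⊖ n) (ℤ.+ n) ⟩
    ℤ.+ a ℤ.+ (m ℤ.⊖ n ℤ.+ ℤ.+ n)     ≡⟨ cong (λ z → ℤ.+ a ℤ.+ z) (ℤ.distribˡ-⊖-+-pos n m n) ⟩
    ℤ.+ a ℤ.+ ((m + n) ℤ.⊖ n)         ≡⟨ cong (λ z → ℤ.+ a ℤ.+ z) (ℤ.⊖-≥ (m≤n+m n m)) ⟩
    ℤ.+ (a + (m + n ∸ n))             ≡⟨ cong (λ l → ℤ.+ (a + l)) (m+n∸n≡m m n) ⟩
    ℤ.+ (a + m)                       ∎

vec-⊖ : ∀ x → vec x ≡ ( (δ (target x) 1F ℤ.⊖ δ (source x) 1F)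
                      , (δ (target x) 2F ℤ.⊖ δ (source x) 2F)
                      , (δ (target x) 3F ℤ.⊖ δ (source x) 3F))
vec-⊖ r = refl
vec-⊖ g = refl
vec-⊖ y = refl
vec-⊖ b = refl
vec-⊖ o = refl
vec-⊖ s = refl

color-Move : ∀ {N} x p p′ → InT N p → InT N p′ →
  toℤ³ p′ ≡ toℤ³ p +³ vec x ⇔ Move (source x) (target x) (bary N p) (bary N p′)
color-Move {N} x p@(c₁ , c₂ , c₃) p′@(d₁ , d₂ , d₃) p∈ p′∈ = mk⇔
  (λ eq → let eq′ = trans eq (cong (toℤ³ p +³_) (vec-⊖ x)) in
    Move-from-tail (trans (sum-bary p p∈) (sym (sum-bary p′ p′∈))) λ where
      0F → to (⊖-component _ _) (cong proj₁ eq′)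
      1F → to (⊖-component _ _) (cong (proj₁ ∘ proj₂) eq′)
      2F → to (⊖-component _ _) (cong (proj₂ ∘ proj₂) eq′))
  (λ move → trans
    (cong₂ _,_ (from (⊖-component (δ (source x) 1F) (δ (target x) 1F)) (balance move 1F))
      (cong₂ _,_ (from (⊖-component (δ (source x) 2F) (δ (target x) 2F)) (balance move 2F))
                 (from (⊖-component (δ (source x) 3F) (δ (target x) 3F)) (balance move 3F))))
    (cong (toℤ³ p +³_) (sym (vec-⊖ x))))

-- The roles of the four entries: 0 is constant on each layer, 2 is the height, and a covering
-- relation moves a unit from 1 or 3 to 2.
point : (Fin 4 → ℕ) → ℕ³
point w = w 1F + (w 3F + w 2F) , w 3F + w 2F , w 2F

⋖-inv : ∀ {m i h m′ i′ h′} → (m , i , h) ⋖ (m′ , i′ , h′) →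
  m ≡ m′ × h′ ≡ suc h × (i ≡ i′ ⊎ i′ ≡ suc i)
⋖-inv along  = refl , refl , inj₁ refl
⋖-inv across = refl , refl , inj₂ refl

point-⋖⁺ : ∀ {w w′} → Move 3F 2F w w′ ⊎ Move 1F 2F w w′ → point w ⋖ point w′
point-⋖⁺ {w} {w′} (inj₁ move) = subst (point w ⋖_) eq along
  where
  h≡ : w′ 2F ≡ suc (w 2F)
  h≡ = trans (sym (+-identityʳ _)) (trans (balance move 2F) (+-comm _ 1))
  i≡ : w 3F + w 2F ≡ w′ 3F + w′ 2F
  i≡ = trans (cong (_+ w 2F) (trans (sym (+-identityʳ _)) (trans (sym (balance move 3F)) (+-comm _ 1))))
    (trans (sym (+-suc (w′ 3F) (w 2F))) (cong (w′ 3F +_) (sym h≡)))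
  u≡ : w 1F ≡ w′ 1F
  u≡ = trans (sym (+-identityʳ _)) (trans (sym (balance move 1F)) (+-identityʳ _))
  eq : (w 1F + (w 3F + w 2F) , w 3F + w 2F , suc (w 2F)) ≡ point w′
  eq = cong₂ _,_ (cong₂ _+_ u≡ i≡) (cong₂ _,_ i≡ (sym h≡))
point-⋖⁺ {w} {w′} (inj₂ move) = subst (point w ⋖_) eq across
  where
  h≡ : w′ 2F ≡ suc (w 2F)
  h≡ = trans (sym (+-identityʳ _)) (trans (balance move 2F) (+-comm _ 1))
  i≡ : suc (w 3F + w 2F) ≡ w′ 3F + w′ 2F
  i≡ = trans (sym (+-suc (w 3F) (w 2F))) (cong₂ _+_
    (trans (sym (+-identityʳ _)) (trans (sym (balance move 3F)) (+-identityʳ _))) (sym h≡))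
  u≡ : w 1F ≡ suc (w′ 1F)
  u≡ = trans (sym (+-identityʳ _)) (trans (sym (balance move 1F)) (+-comm _ 1))
  eq : (w 1F + (w 3F + w 2F) , suc (w 3F + w 2F) , suc (w 2F)) ≡ point w′
  eq = cong₂ _,_ (trans (cong (_+ (w 3F + w 2F)) u≡)
      (trans (sym (+-suc (w′ 1F) _)) (cong (w′ 1F +_) i≡)))
    (cong₂ _,_ i≡ (sym h≡))

-- Equality of totals is essential here: `point` does not mention entry 0, and only the total shows
-- that it is unchanged by the move.
point-⋖⁻ : ∀ {w w′} → total w ≡ total w′ → point w ⋖ point w′ → Move 3F 2F w w′ ⊎ Move 1F 2F w w′
point-⋖⁻ {w} {w′} total≡ c with ⋖-inv c
... | m≡ , h≡ , inj₁ i≡ = inj₁ (Move-from-tail {3F} {2F} {w} {w′} total≡ λ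
  { 0F → cong (_+ 0) (sym (+-cancelʳ-≡ _ (w 1F) (w′ 1F) (trans m≡ (cong (w′ 1F +_) (sym i≡)))))
  ; 1F → trans (+-identityʳ _) (trans h≡ (+-comm 1 _))
  ; 2F → +-cancelʳ-≡ (w 2F) _ _ (trans (+-assoc (w′ 3F) 1 (w 2F))
      (trans (cong (w′ 3F +_) (sym h≡)) (trans (sym i≡) (cong (_+ w 2F) (sym (+-identityʳ _)))))) })
... | m≡ , h≡ , inj₂ i≡ = inj₂ (Move-from-tail {1F} {2F} {w} {w′} total≡ λ
  { 0F → +-cancelʳ-≡ (w 3F + w 2F) _ _ (trans (+-assoc (w′ 1F) 1 _)
      (trans (cong (w′ 1F +_) (sym i≡)) (trans (sym m≡) (cong (_+ (w 3F + w 2F)) (sym (+-identityʳ (w 1F)))))))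
  ; 1F → trans (+-identityʳ _) (trans h≡ (+-comm 1 _))
  ; 2F → cong (_+ 0) (+-cancelʳ-≡ (suc (w 2F)) _ _
      (trans (cong (w′ 3F +_) (sym h≡)) (trans i≡ (sym (+-suc (w 3F) (w 2F)))))) })

point-injective : ∀ {w w′} → total w ≡ total w′ → point w ≡ point w′ → ∀ k → w k ≡ w′ k
point-injective {w} {w′} total≡ eq = head-from-sum w w′ total≡ λ
  { 0F → +-cancelʳ-≡ _ (w 1F) (w′ 1F) (trans (cong proj₁ eq) (cong (w′ 1F +_) (sym i≡)))
  ; 1F → h≡
  ; 2F → +-cancelʳ-≡ _ (w 3F) (w′ 3F) (trans i≡ (cong (w′ 3F +_) (sym h≡))) }
  where
  i≡ = cong (proj₁ ∘ proj₂) eq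
  h≡ = cong (proj₂ ∘ proj₂) eq

-- The triples as points of the layers

lookup-injective : ∀ {A : Set} {xs : List A} → Unique xs → ∀ {i j} → lookup xs i ≡ lookup xs j → i ≡ j
lookup-injective {xs = _ ∷ _}  p        {zero}  {zero}  eq = refl
lookup-injective {xs = _ ∷ xs} (x∉ ∷ _) {zero}  {suc j} eq =
  contradiction eq (All.lookup x∉ (∈-lookup {xs = xs} j))
lookup-injective {xs = _ ∷ xs} (x∉ ∷ _) {suc i} {zero}  eq =
  contradiction (sym eq) (All.lookup x∉ (∈-lookup {xs = xs} i))
lookup-injective {xs = _ ∷ _}  (_ ∷ p)  {suc i} {suc j} eq = cong suc (lookup-injective p eq)

module _ (N : ℕ) where

  private
    row₃ : ℕ → ℕ → List ℕ³
    row₃ c₁ c₂ = map (λ c₃ → c₁ , c₂ , c₃) (upTo (suc N))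
    row₂ : ℕ → List ℕ³
    row₂ c₁ = concatMap (row₃ c₁) (upTo (suc N))

  Tlist-unique : Unique (Tlist (2 + N))
  Tlist-unique = Unique.filter⁺ (inT? N) (unique-concatMap {f = row₂} (Unique.upTo⁺ (suc N))
    (λ c₁ → unique-concatMap {f = row₃ c₁} (Unique.upTo⁺ (suc N))
      (λ c₂ → Unique.map⁺ (cong (proj₂ ∘ proj₂)) (Unique.upTo⁺ (suc N)))
      (λ {c₂} {c₂′} z∈ z∈′ → trans (sym (second c₂ z∈)) (second c₂′ z∈′)))
    (λ {c₁} {c₁′} z∈ z∈′ → trans (sym (first c₁ z∈)) (first c₁′ z∈′)))
    where
    second : ∀ {c₁} c₂ {z} → z ∈ row₃ c₁ c₂ → proj₁ (proj₂ z) ≡ c₂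
    second {c₁} c₂ z∈ with _ , _ , refl ← ∈-map⁻ (λ c₃ → c₁ , c₂ , c₃) z∈ = refl
    first : ∀ c₁ {z} → z ∈ row₂ c₁ → proj₁ z ≡ c₁
    first c₁ z∈ with c₂ , _ , z∈ ← ∈-concatMap-elim (row₃ c₁) (upTo (suc N)) z∈
      with _ , _ , refl ← ∈-map⁻ (λ c₃ → c₁ , c₂ , c₃) z∈ = refl

  ∈-Tlist⁻ : ∀ p → p ∈ Tlist (2 + N) → InT N p
  ∈-Tlist⁻ p p∈ = proj₂ (∈-filter⁻ (inT? N) {xs = concatMap row₂ (upTo (suc N))} p∈)

  ∈-Tlist⁺ : ∀ p → InT N p → p ∈ Tlist (2 + N)
  ∈-Tlist⁺ p@(c₁ , c₂ , c₃) p∈ = ∈-filter⁺ (inT? N)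
    (∈-concatMap-intro row₂ (∈-upTo⁺ (s≤s (≤-trans (≤-trans (m≤m+n c₁ c₂) (m≤m+n _ c₃)) p∈)))
      (∈-concatMap-intro (row₃ c₁) (∈-upTo⁺ (s≤s (≤-trans (≤-trans (m≤n+m c₂ c₁) (m≤m+n _ c₃)) p∈)))
        (∈-map⁺ (λ c₃ → c₁ , c₂ , c₃) (∈-upTo⁺ (s≤s (≤-trans (m≤n+m c₃ _) p∈)))))) p∈

  elt-InT : ∀ j → InT N (elt (2 + N) j)
  elt-InT j = ∈-Tlist⁻ _ (∈-lookup {xs = Tlist (2 + N)} j)

  coords : Fin (size (2 + N)) → Fin 4 → ℕ
  coords j = bary N (elt (2 + N) j)

  sum-coords : ∀ j → total (coords j) ≡ N
  sum-coords j = sum-bary (elt (2 + N) j) (elt-InT j)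

  -- π sends each role (0 constant, 2 height, 1 and 3 the entries giving up a unit) to the
  -- barycentric coordinate playing it. Any π gives a bijection onto the points; only the comparison
  -- of covers with moves depends on the colours.
  module Frame (π : Permutation′ 4) where

    roles : Fin (size (2 + N)) → Fin 4 → ℕ
    roles j = coords j ∘ (π ⟨$⟩ʳ_)

    sum-roles : ∀ j → total (roles j) ≡ N
    sum-roles j = trans (sym (total-permute (coords j) π)) (sum-coords j)

    sum-roles-≡ : ∀ j j′ → total (roles j) ≡ total (roles j′)
    sum-roles-≡ j j′ = trans (sum-roles j) (sym (sum-roles j′))

    κ : Fin (size (2 + N)) → ℕ³
    κ j = point (roles j)

    κ-injective : ∀ {j j′} → κ j ≡ κ j′ → j ≡ j′
    κ-injective {j} {j′} eq = lookup-injective Tlist-unique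
      (cong₂ _,_ (coords≡ 1F) (cong₂ _,_ (coords≡ 2F) (coords≡ 3F)))
      where
      coords≡ : ∀ k → coords j k ≡ coords j′ k
      coords≡ k = subst (λ k → coords j k ≡ coords j′ k) (inverseʳ π {k})
        (point-injective {roles j} {roles j′} (sum-roles-≡ j j′) eq (π ⟨$⟩ˡ k))

    κ-point : ∀ j → IsPoint N (κ j)
    κ-point j = m≤n+m _ (w 3F) , m≤n+m _ (w 1F) , (begin
      w 1F + (w 3F + w 2F)        ≡⟨ cong (w 1F +_) (trans (+-comm (w 3F) (w 2F))
                                       (cong (w 2F +_) (sym (+-identityʳ (w 3F))))) ⟩
      w 1F + (w 2F + (w 3F + 0))  ≤⟨ m≤n+m _ (w 0F) ⟩
      total w                       ≡⟨ sum-roles j ⟩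
      N                           ∎)
      where
      open ≤-Reasoning
      w = roles j

    κ-surjective : ∀ p → IsPoint N p → ∃ λ j → κ j ≡ p
    κ-surjective (m , i , h) (h≤i , i≤m , m≤N) = j , (begin
      κ j      ≡⟨ point-cong (λ k → trans (coords≡ (π ⟨$⟩ʳ k)) (cong w (inverseˡ π))) ⟩
      point w  ≡⟨ cong₂ _,_ (trans (cong (_+_ (m ∸ i)) (m∸n+n≡m h≤i)) (m∸n+n≡m i≤m))
                            (cong (_, h) (m∸n+n≡m h≤i)) ⟩
      (m , i , h) ∎)
      where
      open ≡-Reasoning
      -- The inverse of `point`: the successive differences in h ≤ i ≤ m ≤ N. Composing with the
      -- inverse of π returns from roles to coordinates.
      w : Fin 4 → ℕ
      w 0F = N ∸ m
      w 1F = m ∸ i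
      w 2F = h
      w 3F = i ∸ h
      sum-w : total w ≡ N
      sum-w = begin
        N ∸ m + (m ∸ i + (h + (i ∸ h + 0))) ≡⟨ cong (λ l → N ∸ m + (m ∸ i + (h + l))) (+-identityʳ _) ⟩
        N ∸ m + (m ∸ i + (h + (i ∸ h)))     ≡⟨ cong (λ l → N ∸ m + (m ∸ i + l)) (m+[n∸m]≡n h≤i) ⟩
        N ∸ m + (m ∸ i + i)                 ≡⟨ cong (_+_ (N ∸ m)) (m∸n+n≡m i≤m) ⟩
        N ∸ m + m                           ≡⟨ m∸n+n≡m m≤N ⟩
        N                                   ∎
      q : Fin 4 → ℕ
      q = w ∘ (π ⟨$⟩ˡ_)
      sum-q : total q ≡ N
      sum-q = trans (sym (total-permute w (Perm.flip π))) sum-w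
      p : ℕ³
      p = q 1F , q 2F , q 3F
      p∈ : InT N p
      p∈ = subst (q 1F + q 2F + q 3F ≤_) sum-q
        (≤-trans (≤-reflexive (sym (+-assoc₃ (q 1F) (q 2F) (q 3F)))) (m≤n+m _ (q 0F)))
      j = index (∈-Tlist⁺ p p∈)
      coords≡ : ∀ k → coords j k ≡ q k
      coords≡ k = trans (cong (λ p → bary N p k) (sym (lookup-index (∈-Tlist⁺ p p∈))))
        (head-from-sum (bary N p) q (trans (sum-bary p p∈) (sym sum-q))
          (λ { 0F → refl ; 1F → refl ; 2F → refl }) k)
      point-cong : ∀ {w w′} → (∀ k → w k ≡ w′ k) → point w ≡ point w′
      point-cong {w} {w′} eq = cong₂ _,_ (cong₂ _+_ (eq 1F) (cong₂ _+_ (eq 3F) (eq 2F)))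
        (cong₂ _,_ (cong₂ _+_ (eq 3F) (eq 2F)) (eq 2F))

    open Ideals {N} κ κ-injective κ-point κ-surjective public

    ⋖-Move : ∀ j j′ → κ j ⋖ κ j′ ⇔
      (Move (π ⟨$⟩ʳ 1F) (π ⟨$⟩ʳ 2F) (coords j) (coords j′) ⊎
       Move (π ⟨$⟩ʳ 3F) (π ⟨$⟩ʳ 2F) (coords j) (coords j′))
    ⋖-Move j j′ = mk⇔
      (λ c → Sum.map (from permute) (from permute)
        (Sum.swap (point-⋖⁻ {roles j} {roles j′} (sum-roles-≡ j j′) c)))
      (λ m → point-⋖⁺ (Sum.swap (Sum.map (to permute) (to permute) m)))
      where
      permute : ∀ {a c} → Move (π ⟨$⟩ʳ a) (π ⟨$⟩ʳ c) (coords j) (coords j′) ⇔ Move a c (roles j) (roles j′)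
      permute = Move-permute π

  cover-Move : ∀ x₁ x₂ j j′ → Cover (2 + N) (x₁ ∷ x₂ ∷ []) j j′ ⇔
    (Move (source x₁) (target x₁) (coords j) (coords j′) ⊎
     Move (source x₂) (target x₂) (coords j) (coords j′))
  cover-Move x₁ x₂ j j′ = mk⇔
    (λ { (x , here refl , eq)         → inj₁ (to (color x) eq)
       ; (x , there (here refl) , eq) → inj₂ (to (color x) eq) })
    [ (λ m → x₁ , here refl , from (color x₁) m) , (λ m → x₂ , there (here refl) , from (color x₂) m) ]′
    where
    color = λ x → color-Move x (elt (2 + N) j) (elt (2 + N) j′) (elt-InT j) (elt-InT j′)

  Counted : (Fin (size (2 + N)) → Fin (size (2 + N)) → Set) → Set
  Counted _≼_ = HasCard (IsIdeal _≼_) (prodCatalan (2 + N))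
    × (∀ k → HasCard (IsIdealOfSize _≼_ k) (coeff k (prodQCat (2 + N))))

  module _ (π : Permutation′ 4) (_≼_ : Fin (size (2 + N)) → Fin (size (2 + N)) → Set) where

    open Frame π

    counted : (∀ I → IsLowerSet I ⇔ IsIdeal _≼_ I) → Counted _≼_
    counted lower⇔ideal = HasCard-cong lower⇔ideal lowerSets-card , λ k →
      HasCard-cong (λ I → mk⇔ (λ (l , e) → to (lower⇔ideal I) l , e) (λ (l , e) → from (lower⇔ideal I) l , e))
        (lowerSets-card-size k)

  up-counted : ∀ π x₁ x₂ →
    source x₁ ≡ π ⟨$⟩ʳ 1F → target x₁ ≡ π ⟨$⟩ʳ 2F → source x₂ ≡ π ⟨$⟩ʳ 3F → target x₂ ≡ π ⟨$⟩ʳ 2F →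
    Counted (Le (2 + N) (x₁ ∷ x₂ ∷ []))
  up-counted π x₁ x₂ s₁ t₁ s₂ t₂ = counted π _ λ I → mk⇔
    (λ lower → closed-Star λ i j c → lower i j (from (⋖-Move i j)
      (Sum.map (Move-≡ s₁ t₁) (Move-≡ s₂ t₂)
        (to (cover-Move x₁ x₂ i j) c))))
    (λ ideal i j c → ideal i j (from (cover-Move x₁ x₂ i j)
      (Sum.map (Move-≡ (sym s₁) (sym t₁)) (Move-≡ (sym s₂) (sym t₂))
        (to (⋖-Move i j) c)) ◅ ε))
    where open Frame π

  -- Here both colours share their source. Reversing a cover exchanges source and target, so in the
  -- dual a unit flows into the common coordinate, as in `up-counted`.
  down-counted : ∀ π x₁ x₂ →
    target x₁ ≡ π ⟨$⟩ʳ 1F → source x₁ ≡ π ⟨$⟩ʳ 2F → target x₂ ≡ π ⟨$⟩ʳ 3F → source x₂ ≡ π ⟨$⟩ʳ 2F →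
    Counted (LeDual (2 + N) (x₁ ∷ x₂ ∷ []))
  down-counted π x₁ x₂ t₁ s₁ t₂ s₂ = counted π _ λ I → mk⇔
    (λ lower → closed-Star-flip λ i j c → lower i j (from (⋖-Move i j)
      (Sum.map (flipped i j t₁ s₁) (flipped i j t₂ s₂) (to (cover-Move x₁ x₂ j i) c))))
    (λ ideal i j c → ideal i j (from (cover-Move x₁ x₂ j i)
      (Sum.map (flipped j i (sym s₁) (sym t₁)) (flipped j i (sym s₂) (sym t₂)) (to (⋖-Move i j) c)) ◅ ε))
    where
    open Frame π
    flipped : ∀ i j {a a′ c c′} → a ≡ a′ → c ≡ c′ → Move c a (coords j) (coords i) → Move a′ c′ (coords i) (coords j)
    flipped i j a≡ c≡ = Move-≡ a≡ c≡ ∘ Move-flip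

  -- The colours dictate π: 2 goes to the common target, 1 and 3 to the two sources, 0 to the
  -- untouched coordinate. That coordinate is c₃, the slack, c₂ and c₁ in the four cases; for `y`
  -- and `o` the result is the 4-cycle 0, 2, 3, 1.
  S₁-counted : ∀ {S} → S ∈ S₁-choices → Counted (Le (2 + N) S)
  S₁-counted (here refl) =
    up-counted (transpose 0F 3F) b g refl refl refl refl
  S₁-counted (there (here refl)) =
    up-counted Perm.id b s refl refl refl refl
  S₁-counted (there (there (here refl))) =
    up-counted (transpose 0F 2F ∘ₚ transpose 0F 3F ∘ₚ transpose 0F 1F) y o refl refl refl refl
  S₁-counted (there (there (there (here refl)))) =
    up-counted (transpose 0F 1F) g s refl refl refl refl

  -- Here 2 goes to the common source, and 1 and 3 to the two targets; the untouched coordinates are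
  -- c₂, c₃, c₁ and the slack.
  S₂-counted : ∀ {S} → S ∈ S₂-choices → Counted (LeDual (2 + N) S)
  S₂-counted (here refl) =
    down-counted (transpose 0F 2F) r y refl refl refl refl
  S₂-counted (there (here refl)) =
    down-counted (transpose 0F 3F ∘ₚ transpose 0F 2F) r g refl refl refl refl
  S₂-counted (there (there (here refl))) =
    down-counted (Perm.flip (transpose 0F 2F ∘ₚ transpose 0F 3F ∘ₚ transpose 0F 1F)) y g refl refl refl refl
  S₂-counted (there (there (there (here refl)))) =
    down-counted (transpose 1F 2F) b o refl refl refl refl

  -- Complementation preserves the number of ideals but turns size k into the size of T_n minus k,
  -- so it transfers the cardinality while the q-count stays with the dual.
  dual-card : ∀ {k S} → HasCard (IsIdeal (LeDual (2 + N) S)) k → HasCard (IsIdeal (Le (2 + N) S)) k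
  dual-card h = HasCard-cong (λ I → closed-∁) (HasCard-∁ h)

-- Product formulas for Catalan numbers

-- Σ_{k<n} a_k b_{n-1-k}
convolve : (a b : ℕ → ℕ) → ℕ → ℕ
convolve a c n = sum (zipWith _*_ (applyUpTo a n) (applyDownFrom c n))

convolve-cong : ∀ {a a′ c} n → (∀ k → k < n → a k ≡ a′ k) → convolve a c n ≡ convolve a′ c n
convolve-cong         zero    eq = refl
convolve-cong {c = c} (suc n) eq =
  cong₂ _+_ (cong (_* c n) (eq 0 (s≤s z≤n))) (convolve-cong n (λ k k<n → eq (suc k) (s≤s k<n)))

convolve-last : ∀ a c n → convolve a c (suc n) ≡ convolve a (c ∘ suc) n + a n * c 0
convolve-last a c zero    = +-comm (a 0 * c 0) 0
convolve-last a c (suc n) = trans (cong (_+_ (a 0 * c (suc n))) (convolve-last (a ∘ suc) c n))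
  (sym (+-assoc (a 0 * c (suc n)) _ _))

convolve-comm : ∀ a c n → convolve a c n ≡ convolve c a n
convolve-comm a c zero    = refl
convolve-comm a c (suc n) = begin
  a 0 * c n + convolve (a ∘ suc) c n ≡⟨ cong₂ _+_ (*-comm (a 0) (c n)) (convolve-comm (a ∘ suc) c n) ⟩
  c n * a 0 + convolve c (a ∘ suc) n ≡⟨ +-comm (c n * a 0) _ ⟩
  convolve c (a ∘ suc) n + c n * a 0 ≡⟨ convolve-last c a n ⟨
  convolve c a (suc n)               ∎
  where open ≡-Reasoning

-- The two indices in each product add up to n, so the weights e + p k and p (n - k) add up to the
-- constant e + p n. The offset e is general because peeling off the first term replaces it by e +
-- p.
convolve-affine : ∀ p e a c n →
  convolve (λ k → (e + p * k) * a k) c (suc n) + convolve a (λ k → (p * k) * c k) (suc n) ≡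
  (e + p * n) * convolve a c (suc n)
convolve-affine p e a c zero = solve 4
  (λ p e x z → ((e :+ p :* con 0) :* x :* z :+ con 0) :+ (x :* (p :* con 0 :* z) :+ con 0)
    := (e :+ p :* con 0) :* (x :* z :+ con 0)) refl p e (a 0) (c 0)
  where open +-*-Solver
convolve-affine p e a c (suc n) = begin
  ((e + p * 0) * a 0 * c (suc n) + convolve (λ k → (e + p * suc k) * a (suc k)) c (suc n))
    + (a 0 * (p * suc n * c (suc n)) + V)
    ≡⟨ cong (λ l → ((e + p * 0) * a 0 * c (suc n) + l) + (a 0 * (p * suc n * c (suc n)) + V))
         (convolve-cong (suc n) (λ k _ → cong (_* a (suc k)) (reweigh k))) ⟩
  ((e + p * 0) * a 0 * c (suc n) + U) + (a 0 * (p * suc n * c (suc n)) + V)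
    ≡⟨ solve 7 (λ p e n x z U V →
         ((e :+ p :* con 0) :* x :* z :+ U) :+ (x :* (p :* n :* z) :+ V)
         := (e :+ p :* n) :* (x :* z) :+ (U :+ V)) refl p e (suc n) (a 0) (c (suc n)) U V ⟩
  (e + p * suc n) * (a 0 * c (suc n)) + (U + V)
    ≡⟨ cong (_+_ ((e + p * suc n) * (a 0 * c (suc n)))) (convolve-affine p (e + p) (a ∘ suc) c n) ⟩
  (e + p * suc n) * (a 0 * c (suc n)) + (e + p + p * n) * convolve (a ∘ suc) c (suc n)
    ≡⟨ cong (λ l → (e + p * suc n) * (a 0 * c (suc n)) + l * convolve (a ∘ suc) c (suc n)) (reweigh n) ⟨
  (e + p * suc n) * (a 0 * c (suc n)) + (e + p * suc n) * convolve (a ∘ suc) c (suc n)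
    ≡⟨ *-distribˡ-+ (e + p * suc n) (a 0 * c (suc n)) _ ⟨
  (e + p * suc n) * convolve a c (suc (suc n)) ∎
  where
  open ≡-Reasoning
  open +-*-Solver
  U = convolve (λ k → (e + p + p * k) * a (suc k)) c (suc n)
  V = convolve (a ∘ suc) (λ k → (p * k) * c k) (suc n)
  reweigh : ∀ k → e + p * suc k ≡ e + p + p * k
  reweigh k = trans (cong (e +_) (*-suc p k)) (sym (+-assoc e p (p * k)))

-- Symmetrising k ↦ n - k, the weight e + p k may be replaced by its average e + p n / 2.
convolve-average : ∀ p e a n →
  -- `V` carries the weight p k on the second factor. By commutativity it equals the same sum with
  -- the weight on the first factor, so 2 V = p n S; adding 2 V to both sides avoids subtraction.
  2 * convolve (λ k → (e + p * k) * a k) a (suc n) ≡ (2 * e + p * n) * convolve a a (suc n)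
convolve-average p e a n = +-cancelʳ-≡ (2 * V) _ _ (begin
  2 * U + 2 * V                   ≡⟨ *-distribˡ-+ 2 U V ⟨
  2 * (U + V)                     ≡⟨ cong (2 *_) (convolve-affine p e a a n) ⟩
  2 * ((e + p * n) * S)           ≡⟨ solve 3 (λ e q S → con 2 :* ((e :+ q) :* S)
                                       := (con 2 :* e :+ q) :* S :+ q :* S) refl e (p * n) S ⟩
  (2 * e + p * n) * S + p * n * S ≡⟨ cong (_+_ ((2 * e + p * n) * S)) (convolve-affine p 0 a a n) ⟨
  (2 * e + p * n) * S + (convolve (λ k → p * k * a k) a (suc n) + V)
    ≡⟨ cong (λ l → (2 * e + p * n) * S + (l + V)) (convolve-comm (λ k → p * k * a k) a (suc n)) ⟩
  (2 * e + p * n) * S + (V + V)   ≡⟨ cong (λ l → (2 * e + p * n) * S + (V + l)) (+-identityʳ V) ⟨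
  (2 * e + p * n) * S + 2 * V     ∎)
  where
  open ≡-Reasoning
  open +-*-Solver
  U = convolve (λ k → (e + p * k) * a k) a (suc n)
  V = convolve a (λ k → (p * k) * a k) (suc n)
  S = convolve a a (suc n)

-- Average the weight 1 + k in the convolution for C_{n+2}: twice the weighted sum is (n + 3)
-- C_{n+2}. Apart from the term k = 0, which is C_{n+1}, the induction hypothesis turns the weighted
-- terms (k + 2) C_{k+1} into (2 + 4 k) C_k, and averaging this weight in the convolution for
-- C_{n+1} gives twice the rest as (4 + 4 n) C_{n+1}.
catalan-ratio : ∀ n → (2 + n) * catalan (suc n) ≡ (2 + 4 * n) * catalan n
catalan-ratio = <-rec _ step
  where
  open ≡-Reasoning
  weighted : ℕ → ℕ → ℕ → ℕ
  weighted p e = convolve (λ k → (e + p * k) * catalan k) catalan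
  average : ∀ p e n → 2 * weighted p e (suc n) ≡ (2 * e + p * n) * catalan (suc n)
  average p e n = trans (convolve-average p e catalan n) (cong ((2 * e + p * n) *_) (sym (catalan-suc n)))
  step : ∀ n → (∀ {k} → k < n → (2 + k) * catalan (suc k) ≡ (2 + 4 * k) * catalan k) →
    (2 + n) * catalan (suc n) ≡ (2 + 4 * n) * catalan n
  step zero    ih = refl
  step (suc n) ih = begin
    (3 + n) * catalan (2 + n)
      ≡⟨ cong (λ l → (2 + l) * catalan (2 + n)) (+-identityʳ (suc n)) ⟨
    (2 * 1 + 1 * suc n) * catalan (2 + n)
      ≡⟨ average 1 1 (suc n) ⟨
    2 * weighted 1 1 (2 + n)
      ≡⟨ cong (2 *_) (cong₂ _+_ (+-identityʳ (catalan (suc n))) (convolve-cong (suc n) λ k k≤n →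
           trans (cong (λ l → suc (suc l) * catalan (suc k)) (+-identityʳ k)) (ih k≤n))) ⟩
    2 * (catalan (suc n) + weighted 4 2 (suc n))
      ≡⟨ *-distribˡ-+ 2 (catalan (suc n)) _ ⟩
    2 * catalan (suc n) + 2 * weighted 4 2 (suc n)
      ≡⟨ cong (_+_ (2 * catalan (suc n))) (average 4 2 n) ⟩
    2 * catalan (suc n) + (4 + 4 * n) * catalan (suc n)
      ≡⟨ solve 2 (λ n c → con 2 :* c :+ (con 4 :+ con 4 :* n) :* c
           := (con 2 :+ con 4 :* (con 1 :+ n)) :* c) refl n (catalan (suc n)) ⟩
    (2 + 4 * suc n) * catalan (suc n) ∎
    where open +-*-Solver

-- Central binomial coefficients

nC0≡1 : ∀ n → n C 0 ≡ 1
nC0≡1 n = trans (nCk≡nC[n∸k] {0} {n} z≤n) (nCn≡1 n)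

-- The absorption identity, by induction through Pascal's rule.
[1+k]*[1+n]C[1+k]≡[1+n]*nCk : ∀ n k → suc k * (suc n C suc k) ≡ suc n * (n C k)
[1+k]*[1+n]C[1+k]≡[1+n]*nCk zero    zero    = refl
[1+k]*[1+n]C[1+k]≡[1+n]*nCk zero    (suc k) = *-zeroʳ (2 + k)
[1+k]*[1+n]C[1+k]≡[1+n]*nCk (suc n) zero    = begin
  1 * ((2 + n) C 1)             ≡⟨ cong (1 *_) (nCk+nC[k+1]≡[n+1]C[k+1] (suc n) 0) ⟨
  1 * (suc n C 0 + suc n C 1)   ≡⟨ *-distribˡ-+ 1 (suc n C 0) _ ⟩
  1 * (suc n C 0) + 1 * (suc n C 1)
    ≡⟨ cong (_+_ (1 * (suc n C 0))) ([1+k]*[1+n]C[1+k]≡[1+n]*nCk n 0) ⟩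
  1 * (suc n C 0) + suc n * (n C 0)
    ≡⟨ cong₂ (λ u v → 1 * u + suc n * v) (nC0≡1 (suc n)) (nC0≡1 n) ⟩
  (2 + n) * 1                   ≡⟨ cong ((2 + n) *_) (nC0≡1 (suc n)) ⟨
  (2 + n) * (suc n C 0)         ∎
  where open ≡-Reasoning
[1+k]*[1+n]C[1+k]≡[1+n]*nCk (suc n) (suc k) = begin
  (2 + k) * ((2 + n) C (2 + k))
    ≡⟨ cong ((2 + k) *_) (nCk+nC[k+1]≡[n+1]C[k+1] (suc n) (suc k)) ⟨
  (2 + k) * (u + suc n C (2 + k))
    ≡⟨ *-distribˡ-+ (2 + k) u _ ⟩
  (2 + k) * u + (2 + k) * (suc n C (2 + k))
    ≡⟨ cong₂ (λ i j → u + i + j) ([1+k]*[1+n]C[1+k]≡[1+n]*nCk n k) ([1+k]*[1+n]C[1+k]≡[1+n]*nCk n (suc k)) ⟩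
  u + suc n * (n C k) + suc n * (n C suc k)
    ≡⟨ +-assoc u _ _ ⟩
  u + (suc n * (n C k) + suc n * (n C suc k))
    ≡⟨ cong (u +_) (*-distribˡ-+ (suc n) (n C k) _) ⟨
  u + suc n * (n C k + n C suc k)
    ≡⟨ cong (λ l → u + suc n * l) (nCk+nC[k+1]≡[n+1]C[k+1] n k) ⟩
  (2 + n) * u ∎
  where
  open ≡-Reasoning
  u = suc n C suc k

-- Absorption twice, with the symmetry of row 2 j + 1 in between to bring its lower index from j to
-- j + 1. Together with `catalan-ratio` it matches the two sides of the closed form step by step.
central-C-ratio : ∀ j → suc j * ((2 * suc j) C suc j) ≡ (2 + 4 * j) * ((2 * j) C j)
central-C-ratio j = *-cancelˡ-≡ _ _ (suc j) (begin
  suc j * (suc j * ((2 * suc j) C suc j))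
    ≡⟨ cong (λ l → suc j * (suc j * (l C suc j))) 2[1+j]≡2+2j ⟩
  suc j * (suc j * ((2 + 2 * j) C suc j))
    ≡⟨ cong (suc j *_) ([1+k]*[1+n]C[1+k]≡[1+n]*nCk (suc (2 * j)) j) ⟩
  suc j * ((2 + 2 * j) * (suc (2 * j) C j))
    ≡⟨ cong (λ l → suc j * ((2 + 2 * j) * l)) (trans (nCk≡nC[n∸k] (≤-trans (m≤m+n j _) (n≤1+n _)))
         (cong (suc (2 * j) C_) [1+2j]∸j)) ⟩
  suc j * ((2 + 2 * j) * (suc (2 * j) C suc j))
    ≡⟨ solve 3 (λ a c d → a :* (c :* d) := c :* (a :* d)) refl (suc j) (2 + 2 * j) (suc (2 * j) C suc j) ⟩
  (2 + 2 * j) * (suc j * (suc (2 * j) C suc j))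
    ≡⟨ cong ((2 + 2 * j) *_) ([1+k]*[1+n]C[1+k]≡[1+n]*nCk (2 * j) j) ⟩
  (2 + 2 * j) * (suc (2 * j) * ((2 * j) C j))
    ≡⟨ solve 2 (λ j c → (con 2 :+ con 2 :* j) :* ((con 1 :+ con 2 :* j) :* c)
         := (con 1 :+ j) :* ((con 2 :+ con 4 :* j) :* c)) refl j ((2 * j) C j) ⟩
  suc j * ((2 + 4 * j) * ((2 * j) C j)) ∎)
  where
  open ≡-Reasoning
  open +-*-Solver
  2[1+j]≡2+2j : 2 * suc j ≡ 2 + 2 * j
  2[1+j]≡2+2j = *-suc 2 j
  [1+2j]∸j : suc (2 * j) ∸ j ≡ suc j
  [1+2j]∸j = trans (cong (_∸ j) (trans (cong (λ l → suc (j + l)) (+-identityʳ j)) (sym (+-suc j j)))) (m+n∸m≡n j (suc j))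

catalan-C : ∀ j → suc j * catalan j ≡ (2 * j) C j
catalan-C zero    = refl
catalan-C (suc j) = *-cancelˡ-≡ _ _ (suc j) (begin
  suc j * ((2 + j) * catalan (suc j))   ≡⟨ cong (suc j *_) (catalan-ratio j) ⟩
  suc j * ((2 + 4 * j) * catalan j)     ≡⟨ solve 3 (λ a c d → a :* (c :* d) := c :* (a :* d)) refl
                                             (suc j) (2 + 4 * j) (catalan j) ⟩
  (2 + 4 * j) * (suc j * catalan j)     ≡⟨ cong ((2 + 4 * j) *_) (catalan-C j) ⟩
  (2 + 4 * j) * ((2 * j) C j)           ≡⟨ central-C-ratio j ⟨
  suc j * ((2 * suc j) C suc j)         ∎)
  where
  open ≡-Reasoning
  open +-*-Solver

-- Products of rational numbers

qdiv-cong : ∀ {a c a′ c′} → a * suc c′ ≡ a′ * suc c → qdiv a (suc c) ≡ qdiv a′ (suc c′)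
qdiv-cong {a} {c} {a′} {c′} eq = ℚ.fromℚᵘ-cong {mkℚᵘ (ℤ.+ a) c} {mkℚᵘ (ℤ.+ a′) c′} (*≡* (begin
  ℤ.+ a ℤ.* ℤ.+ suc c′  ≡⟨ ℤ.pos-* a (suc c′) ⟨
  ℤ.+ (a * suc c′)      ≡⟨ cong ℤ.+_ eq ⟩
  ℤ.+ (a′ * suc c)      ≡⟨ ℤ.pos-* a′ (suc c) ⟩
  ℤ.+ a′ ℤ.* ℤ.+ suc c  ∎))
  where open ≡-Reasoning

-- Reduced fractions do not multiply entry by entry, so the identity is checked among unnormalised
-- fractions, where they do.
qdiv-* : ∀ a c a′ c′ → qdiv a (suc c) ℚ.* qdiv a′ (suc c′) ≡ qdiv (a * a′) (suc c * suc c′)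
qdiv-* a c a′ c′ = ℚ.toℚᵘ-injective (begin
  toℚᵘ (fromℚᵘ p ℚ.* fromℚᵘ q)            ≈⟨ ℚ.toℚᵘ-homo-* (fromℚᵘ p) (fromℚᵘ q) ⟩
  toℚᵘ (fromℚᵘ p) ℚᵘ.* toℚᵘ (fromℚᵘ q)    ≈⟨ ℚᵘ.*-cong (ℚ.toℚᵘ-fromℚᵘ p) (ℚ.toℚᵘ-fromℚᵘ q) ⟩
  p ℚᵘ.* q                                ≈⟨ *≡* (cong (ℤ._* (ℤ.+ (suc c * suc c′))) (sym (ℤ.pos-* a a′))) ⟩
  mkℚᵘ (ℤ.+ (a * a′)) (c′ + c * suc c′)   ≈⟨ ℚ.toℚᵘ-fromℚᵘ _ ⟨
  toℚᵘ (qdiv (a * a′) (suc c * suc c′))   ∎)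
  where
  open ℚᵘ.≃-Reasoning
  p = mkℚᵘ (ℤ.+ a) c
  q = mkℚᵘ (ℤ.+ a′) c′

Π : ℕ → ℕ → (ℕ → ℚ) → ℚ
Π a c f = prodℚ (map f (range a c))

prodℚ-++ : ∀ xs ys → prodℚ (xs ++ ys) ≡ prodℚ xs ℚ.* prodℚ ys
prodℚ-++ []       ys = sym (ℚ.*-identityˡ (prodℚ ys))
prodℚ-++ (x ∷ xs) ys = trans (cong (x ℚ.*_) (prodℚ-++ xs ys)) (sym (ℚ.*-assoc x (prodℚ xs) (prodℚ ys)))

prodℚ-concatMap : ∀ {A : Set} (f : A → List ℚ) xs → prodℚ (concatMap f xs) ≡ prodℚ (map (prodℚ ∘ f) xs)
prodℚ-concatMap f []       = refl
prodℚ-concatMap f (x ∷ xs) = trans (prodℚ-++ (f x) _) (cong (prodℚ (f x) ℚ.*_) (prodℚ-concatMap f xs))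

range-suc : ∀ {a c} → a ≤ suc c → range a (suc c) ≡ range a c ++ suc c ∷ []
range-suc {a} {c} a≤ = begin
  map (a +_) (upTo (suc (suc c) ∸ a))
    ≡⟨ cong (map (a +_) ∘ upTo) (+-∸-assoc 1 a≤) ⟩
  map (a +_) (upTo (suc (suc c ∸ a)))
    ≡⟨ cong (map (a +_)) (upTo-∷ʳ (suc c ∸ a)) ⟨
  map (a +_) (upTo (suc c ∸ a) ++ (suc c ∸ a) ∷ [])
    ≡⟨ map-++ (a +_) (upTo (suc c ∸ a)) _ ⟩
  range a c ++ (a + (suc c ∸ a)) ∷ []
    ≡⟨ cong (λ l → range a c ++ l ∷ []) (m+[n∸m]≡n a≤) ⟩
  range a c ++ suc c ∷ [] ∎
  where open ≡-Reasoning

Π-suc : ∀ {a c} f → a ≤ suc c → Π a (suc c) f ≡ Π a c f ℚ.* f (suc c)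
Π-suc {a} {c} f a≤ = begin
  prodℚ (map f (range a (suc c)))                ≡⟨ cong (prodℚ ∘ map f) (range-suc a≤) ⟩
  prodℚ (map f (range a c ++ suc c ∷ []))        ≡⟨ cong prodℚ (map-++ f (range a c) _) ⟩
  prodℚ (map f (range a c) ++ f (suc c) ∷ [])    ≡⟨ prodℚ-++ (map f (range a c)) _ ⟩
  Π a c f ℚ.* (f (suc c) ℚ.* 1ℚ)                 ≡⟨ cong (ℚ._*_ (Π a c f)) (ℚ.*-identityʳ (f (suc c))) ⟩
  Π a c f ℚ.* f (suc c)                          ∎
  where open ≡-Reasoning

Π-empty : ∀ c f → Π (suc c) c f ≡ 1ℚ
Π-empty c f = cong (prodℚ ∘ map f ∘ map (suc c +_) ∘ upTo) (n∸n≡0 c)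

Π-cong : ∀ {a c f f′} → a ≤ suc c → (∀ x → x ≤ c → f x ≡ f′ x) → Π a c f ≡ Π a c f′
Π-cong {a} {c} {f} {f′} a≤ eq = cong prodℚ (map-cong-local (All.tabulate agree))
  where
  agree : ∀ {x} → x ∈ range a c → f x ≡ f′ x
  agree x∈ with t , t∈ , refl ← ∈-map⁻ (a +_) x∈ =
    eq (a + t) (s≤s⁻¹ (≤-trans (+-monoʳ-< a (∈-upTo⁻ t∈)) (≤-reflexive (m+[n∸m]≡n a≤))))

Π-* : ∀ a c f f′ → Π a c (λ x → f x ℚ.* f′ x) ≡ Π a c f ℚ.* Π a c f′
Π-* a c f f′ = go (range a c)
  where
  go : ∀ xs → prodℚ (map (λ x → f x ℚ.* f′ x) xs) ≡ prodℚ (map f xs) ℚ.* prodℚ (map f′ xs)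
  go []       = refl
  go (x ∷ xs) = trans (cong (ℚ._*_ (f x ℚ.* f′ x)) (go xs))
    (interchange (CommutativeMonoid.commutativeSemigroup ℚ.*-1-commutativeMonoid) (f x) (f′ x) _ _)

△ : ℕ → (ℕ → ℕ → ℚ) → ℚ
△ M f = Π 1 M λ i → Π i M (f i)

-- Enlarging the triangle adds exactly the pairs with j = M + 1. The new row i = M + 1 has no other
-- entries, so its remaining product is empty.
△-suc : ∀ M f → △ (suc M) f ≡ △ M f ℚ.* Π 1 (suc M) (λ i → f i (suc M))
△-suc M f = begin
  Π 1 (suc M) (λ i → Π i (suc M) (f i))
    ≡⟨ Π-cong {1} {suc M} (s≤s z≤n) (λ i i≤ → Π-suc (f i) i≤) ⟩
  Π 1 (suc M) (λ i → Π i M (f i) ℚ.* f i (suc M))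
    ≡⟨ Π-* 1 (suc M) (λ i → Π i M (f i)) (λ i → f i (suc M)) ⟩
  Π 1 (suc M) (λ i → Π i M (f i)) ℚ.* Π 1 (suc M) (λ i → f i (suc M))
    ≡⟨ cong (ℚ._* Π 1 (suc M) (λ i → f i (suc M))) (begin
         Π 1 (suc M) (λ i → Π i M (f i))        ≡⟨ Π-suc {1} {M} (λ i → Π i M (f i)) (s≤s z≤n) ⟩
         △ M f ℚ.* Π (suc M) M (f (suc M))      ≡⟨ cong (ℚ._*_ (△ M f)) (Π-empty M (f (suc M))) ⟩
         △ M f ℚ.* 1ℚ                           ≡⟨ ℚ.*-identityʳ (△ M f) ⟩
         △ M f                                  ∎) ⟩
  △ M f ℚ.* Π 1 (suc M) (λ i → f i (suc M)) ∎
  where open ≡-Reasoning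

factor : ℕ → ℕ → ℚ
factor i j = qdiv (i + j + 2) (i + j)

-- The product telescopes in steps of 2.
Π-factor : ∀ d t → Π 1 t (λ i → factor i d) ≡ qdiv ((1 + (t + d)) * (2 + (t + d))) ((1 + d) * (2 + d))
Π-factor d zero    = qdiv-cong {1} {0} {(1 + d) * (2 + d)} (*-comm 1 ((1 + d) * (2 + d)))
Π-factor d (suc t) = begin
  Π 1 (suc t) (λ i → factor i d)
    ≡⟨ Π-suc {1} {t} (λ i → factor i d) (s≤s z≤n) ⟩
  Π 1 t (λ i → factor i d) ℚ.* factor (suc t) d
    ≡⟨ cong (ℚ._* factor (suc t) d) (Π-factor d t) ⟩
  qdiv ((1 + (t + d)) * (2 + (t + d))) ((1 + d) * (2 + d)) ℚ.* factor (suc t) d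
    ≡⟨ qdiv-* ((1 + (t + d)) * (2 + (t + d))) _ (suc t + d + 2) (t + d) ⟩
  qdiv ((1 + (t + d)) * (2 + (t + d)) * (suc t + d + 2)) ((1 + d) * (2 + d) * (suc t + d))
    ≡⟨ qdiv-cong {(1 + (t + d)) * (2 + (t + d)) * (suc t + d + 2)} (solve 2 (λ e D →
         (con 1 :+ e) :* (con 2 :+ e) :* (con 1 :+ e :+ con 2) :* D
         := (con 2 :+ e) :* (con 3 :+ e) :* (D :* (con 1 :+ e))) refl (t + d) ((1 + d) * (2 + d))) ⟩
  qdiv ((1 + (suc t + d)) * (2 + (suc t + d))) ((1 + d) * (2 + d)) ∎
  where
  open ≡-Reasoning
  open +-*-Solver

-- This is the part of the triple product with k = M. The column j = M + 1 telescopes to (2 M + 3)(2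
-- M + 4) / ((M + 2)(M + 3)), which `catalan-ratio` identifies with C_{M+2} / C_{M+1}.
△-factor : ∀ M → △ M factor ≡ qdiv (catalan (suc M)) 1
△-factor zero    = refl
△-factor (suc M) = begin
  △ (suc M) factor
    ≡⟨ △-suc M factor ⟩
  △ M factor ℚ.* Π 1 (suc M) (λ i → factor i (suc M))
    ≡⟨ cong₂ ℚ._*_ (△-factor M) (Π-factor (suc M) (suc M)) ⟩
  qdiv (catalan (suc M)) 1 ℚ.* qdiv num den
    ≡⟨ qdiv-* (catalan (suc M)) 0 num _ ⟩
  qdiv (catalan (suc M) * num) (1 * den)
    ≡⟨ qdiv-cong {catalan (suc M) * num} {_} {catalan (2 + M)} (begin
         catalan (suc M) * num * 1
           ≡⟨ solve 2 (λ m c →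
                c :* ((con 1 :+ (con 1 :+ m :+ (con 1 :+ m))) :* (con 2 :+ (con 1 :+ m :+ (con 1 :+ m)))) :* con 1
                := ((con 2 :+ con 4 :* (con 1 :+ m)) :* c) :* (con 2 :+ m)) refl M (catalan (suc M)) ⟩
         ((2 + 4 * suc M) * catalan (suc M)) * (2 + M)
           ≡⟨ cong (_* (2 + M)) (catalan-ratio (suc M)) ⟨
         ((3 + M) * catalan (2 + M)) * (2 + M)
           ≡⟨ solve 2 (λ m c → ((con 3 :+ m) :* c) :* (con 2 :+ m)
                := c :* (con 1 :* ((con 2 :+ m) :* (con 3 :+ m)))) refl M (catalan (2 + M)) ⟩
         catalan (2 + M) * (1 * den) ∎) ⟩
  qdiv (catalan (2 + M)) 1 ∎
  where
  open ≡-Reasoning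
  open +-*-Solver
  num = (1 + (suc M + suc M)) * (2 + (suc M + suc M))
  den = (2 + M) * (3 + M)

catalans : ℕ → ℚ
catalans n = Π 1 n λ j → qdiv (catalan j) 1

triple-△ : ∀ n → prodTriple n ≡ △ (n ∸ 1) (λ i j → Π j (n ∸ 1) (λ _ → factor i j))
triple-△ n = trans (prodℚ-concatMap _ (range 1 (n ∸ 1))) (cong prodℚ (map-cong
  (λ i → prodℚ-concatMap _ (range i (n ∸ 1))) (range 1 (n ∸ 1))))

-- Induction on the largest k: the slice k = M + 1 is split off as a triangle worth C_{M+2}. What
-- remains still ranges over j ≤ M + 1, but for j = M + 1 no k is left and the factors are 1.
△-triple : ∀ M → △ M (λ i j → Π j M (λ _ → factor i j)) ≡ catalans (suc M)
△-triple zero    = refl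
△-triple (suc M) = begin
  △ (suc M) (λ i j → Π j (suc M) (λ _ → factor i j))
    ≡⟨ Π-cong {1} {suc M} (s≤s z≤n) (λ i i≤ → Π-cong {i} {suc M} (m≤n⇒m≤1+n i≤)
         (λ j j≤ → Π-suc (λ _ → factor i j) j≤)) ⟩
  △ (suc M) (λ i j → inner i j ℚ.* factor i j)
    ≡⟨ cong prodℚ (map-cong (λ i → Π-* i (suc M) (inner i) (factor i)) (range 1 (suc M))) ⟩
  Π 1 (suc M) (λ i → Π i (suc M) (inner i) ℚ.* Π i (suc M) (factor i))
    ≡⟨ Π-* 1 (suc M) (λ i → Π i (suc M) (inner i)) (λ i → Π i (suc M) (factor i)) ⟩
  △ (suc M) inner ℚ.* △ (suc M) factor
    ≡⟨ cong₂ ℚ._*_ (begin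
         △ (suc M) inner
           ≡⟨ △-suc M inner ⟩
         △ M inner ℚ.* Π 1 (suc M) (λ i → inner i (suc M))
           ≡⟨ cong₂ ℚ._*_ (△-triple M) (trans
                (cong prodℚ (map-cong (λ i → Π-empty M (λ _ → factor i (suc M))) (range 1 (suc M))))
                (ones (range 1 (suc M)))) ⟩
         catalans (suc M) ℚ.* 1ℚ
           ≡⟨ ℚ.*-identityʳ (catalans (suc M)) ⟩
         catalans (suc M) ∎)
       (△-factor (suc M)) ⟩
  catalans (suc M) ℚ.* qdiv (catalan (2 + M)) 1
    ≡⟨ Π-suc {1} {suc M} (λ j → qdiv (catalan j) 1) (s≤s z≤n) ⟨
  catalans (2 + M) ∎
  where
  open ≡-Reasoning
  inner : ℕ → ℕ → ℚ
  inner i j = Π j M (λ _ → factor i j)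
  ones : ∀ (xs : List ℕ) → prodℚ (map (λ _ → 1ℚ) xs) ≡ 1ℚ
  ones []       = refl
  ones (_ ∷ xs) = trans (ℚ.*-identityˡ _) (ones xs)

prodCatalan-ℚ : ∀ n → (ℤ.+ prodCatalan n) / 1 ≡ catalans n
prodCatalan-ℚ n = go (range 1 n)
  where
  go : ∀ ks → (ℤ.+ prodℕ (map catalan ks)) / 1 ≡ prodℚ (map (λ j → qdiv (catalan j) 1) ks)
  go []       = refl
  go (k ∷ ks) = trans (sym (qdiv-* (catalan k) 0 (prodℕ (map catalan ks)) 0))
    (cong (ℚ._*_ (qdiv (catalan k) 1)) (go ks))

prodBinom-catalans : ∀ n → prodBinom n ≡ catalans n
prodBinom-catalans n = cong prodℚ (map-cong binom (range 1 n))
  where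
  binom : ∀ j → qdiv 1 (j + 1) ℚ.* qdiv ((2 * j) C j) 1 ≡ qdiv (catalan j) 1
  binom j = begin
    qdiv 1 (j + 1) ℚ.* qdiv ((2 * j) C j) 1   ≡⟨ cong (λ l → qdiv 1 l ℚ.* qdiv ((2 * j) C j) 1) (+-comm j 1) ⟩
    qdiv 1 (suc j) ℚ.* qdiv ((2 * j) C j) 1   ≡⟨ qdiv-* 1 j ((2 * j) C j) 0 ⟩
    qdiv (1 * ((2 * j) C j)) (suc j * 1)      ≡⟨ qdiv-cong {1 * ((2 * j) C j)} {_} {catalan j} (trans
                                                   (cong (λ l → 1 * l * 1) (sym (catalan-C j)))
                                                   (solve 2 (λ j c → con 1 :* ((con 1 :+ j) :* c) :* con 1
                                                     := c :* ((con 1 :+ j) :* con 1)) refl j (catalan j))) ⟩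
    qdiv (catalan j) 1                        ∎
    where
    open ≡-Reasoning
    open +-*-Solver

prodTriple-catalans : ∀ n → prodTriple (2 + n) ≡ catalans (2 + n)
prodTriple-catalans n = trans (triple-△ (2 + n)) (△-triple (suc n))

prodCatalan≡prodBinom : ∀ n → (ℤ.+ prodCatalan n) / 1 ≡ prodBinom n
prodCatalan≡prodBinom n = trans (prodCatalan-ℚ n) (sym (prodBinom-catalans n))

prodBinom≡prodTriple : ∀ n → prodBinom (2 + n) ≡ prodTriple (2 + n)
prodBinom≡prodTriple n = trans (prodBinom-catalans (2 + n)) (sym (prodTriple-catalans n))

open import Data.Integer using (+_)

theorem9 : (n : ℕ) → 2 ≤ n → (S₁ S₂ : List Color) → S₁ ∈ S₁-choices → S₂ ∈ S₂-choices →
    (HasCard (IsIdeal (Le n S₁)) (prodCatalan n)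
    × HasCard (IsIdeal (Le n S₂)) (prodCatalan n)
    × (+ prodCatalan n) / 1 ≡ prodBinom n
    × prodBinom n ≡ prodTriple n)
    × ((k : ℕ) → HasCard (IsIdealOfSize (Le n S₁) k) (coeff k (prodQCat n))
    × HasCard (IsIdealOfSize (LeDual n S₂) k) (coeff k (prodQCat n)))
-- With n = 2 + N the bound n ∸ 2 on the coordinate sum computes to N.
theorem9 (suc (suc N)) (s≤s (s≤s z≤n)) S₁ S₂ S₁∈ S₂∈
  = (proj₁ counted₁ , dual-card N (proj₁ counted₂) , prodCatalan≡prodBinom (2 + N) , prodBinom≡prodTriple N)
  , λ k → proj₂ counted₁ k , proj₂ counted₂ k
  where
  counted₁ = S₁-counted N S₁∈
  counted₂ = S₂-counted N S₂∈
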